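{- Let $r\ge 1$ be an integer and put $m=2^r$. For every $n\ge 0$, \[ \nu_2(t_m(n))=\nu_2\binom{n+m-1}{m-1}. \] Moreover, for every integer $s\ge 1$, the sequence \[ \bigl(\operatorname{odd}(t_m(n))\bmod 2^s\bigr)_{n\ge 0} \] is $2$-automatic.
   Context: Let $T(x)=\prod_{j\ge 0}(1-x^{2^j})\in\mathbb Z[[x]]$ be the Thue--Morse generating function, and for each integer $m\ge 1$ define the integers $t_m(n)$ by $T(x)^m=\sum_{n\ge 0}t_m(n)x^n$. For a nonzero integer $a$, $\nu_2(a)$ is the largest integer $v$ such that $2^v$ divides $a$, and $\nu_2(0)=+\infty$. The signed odd part is $\operatorname{odd}(a)=a/2^{\nu_2(a)}$ for $a\neq 0$ and $\operatorname{odd}(0)=0$. A sequence $(a_n)_{n\ge 0}$ with values in a finite set is $2$-automatic if there is a finite automaton which, reading the binary expansion of $n$ from the most significant digit, outputs $a_n$; equivalently, its $2$-kernel $\{(a_{2^e n+c})_{n\ge 0}: e\ge 0,\ 0\le c<2^e\}$ is finite. -}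

module Defs where

open import Data.Bool.Base using (if_then_else_)
open import Data.Digit using (Bit; toDigits)
open import Data.Fin.Base using (Fin; toℕ; fromℕ<)
open import Data.Fin.Properties using (toℕ<n)
open import Data.Integer.Base as ℤ using (ℤ; 0ℤ; 1ℤ; ∣_∣; _/ℕ_; _%ℕ_)
open import Data.Integer.DivMod using (n%ℕd<d)
import Data.Integer.Properties as ℤ
open import Data.List.Base using (List; foldl; reverse)
open import Data.Nat.Base
open import Data.Nat.Divisibility using (_∣_; _∣?_; 1∣_; ∣⇒≤)
open import Data.Nat.Properties
open import Data.Product.Base using (Σ-syntax; proj₁)
open import Relation.Binary.PropositionalEquality
open import Relation.Nullary using (yes; no; does; contradiction)
open import Relation.Nullary.Construct.Add.Supremum using (_⁺; ⊤⁺; [_])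
open import Relation.Unary using (Pred; Decidable)

open import Algebra.Properties.Semiring.Sum ℤ.+-*-semiring
  using (sum⁺-syntax; sum-cong-≗; sum-replicate-zero)

-- ℤ[[x]]: a series is its sequence of coefficients.

Series : Set
Series = ℕ → ℤ

infixl 6 _-ₛ_
infixl 7 _*ₛ_
infixr 8 _^ₛ_ X^_

X^_ : ℕ → Series
(X^ k) n = if n ≡ᵇ k then 1ℤ else 0ℤ

1ₛ : Series
1ₛ = X^ 0

_-ₛ_ : Series → Series → Series
(f -ₛ g) n = f n ℤ.- g n

_*ₛ_ : Series → Series → Series
(f *ₛ g) n = ∑[ i ≤ n ] (f (toℕ i) ℤ.* g (n ∸ toℕ i))

_^ₛ_ : Series → ℕ → Series
f ^ₛ zero  = 1ₛ
f ^ₛ suc m = f *ₛ f ^ₛ m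

partialT : ℕ → Series
partialT zero    = 1ₛ
partialT (suc J) = (1ₛ -ₛ X^ (2 ^ J)) *ₛ partialT J

-- The infinite product is the x-adic limit of the partial products over
-- j < J.  For j ≥ n we have 2 ^ j > n, so the coefficient of xⁿ is already
-- final at J = n; see T-limit.

T : Series
T n = partialT n n

t : ℕ → ℕ → ℤ
t m n = (T ^ₛ m) n

private
  n<2^n : ∀ n → n < 2 ^ n
  n<2^n zero    = s≤s z≤n
  n<2^n (suc n) = begin-strict
    suc n           ≤⟨ n<2^n n ⟩
    2 ^ n           <⟨ m<m+n (2 ^ n) (m^n>0 2 n) ⟩
    2 ^ n + 2 ^ n   ≡⟨ cong (2 ^ n +_) (+-identityʳ (2 ^ n)) ⟨
    2 ^ suc n       ∎
    where open ≤-Reasoning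

  X^-below : ∀ {k n} → n < k → (X^ k) n ≡ 0ℤ
  X^-below {suc k} {zero}  _         = refl
  X^-below {suc k} {suc n} (s≤s n<k) = X^-below {k} {n} n<k

  factor-trivial : ∀ k (f : Series) n → n < k →
                   ((1ₛ -ₛ X^ k) *ₛ f) n ≡ f n
  factor-trivial k f n n<k = begin
    ((1ₛ -ₛ X^ k) *ₛ f) n  ≡⟨ cong₂ ℤ._+_ head≡ (trans (sum-cong-≗ tail≡) (sum-replicate-zero n)) ⟩
    f n ℤ.+ 0ℤ             ≡⟨ ℤ.+-identityʳ (f n) ⟩
    f n                    ∎
    where
    open ≡-Reasoning
    head≡ : (1ₛ -ₛ X^ k) 0 ℤ.* f n ≡ f n
    head≡ rewrite X^-below {k} {0} (≤-<-trans z≤n n<k) = ℤ.*-identityˡ (f n)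
    tail≡ : (i : Fin n) →
            (1ₛ -ₛ X^ k) (suc (toℕ i)) ℤ.* f (n ∸ suc (toℕ i)) ≡ 0ℤ
    tail≡ i rewrite X^-below {k} {suc (toℕ i)} (≤-<-trans (toℕ<n i) n<k) = refl

T-limit : ∀ {n J} → n ≤ J → partialT J n ≡ T n
T-limit n≤J = go (≤⇒≤′ n≤J)
  where
  go : ∀ {n J} → n ≤′ J → partialT J n ≡ T n
  go ≤′-refl = refl
  go {n} (≤′-step {J} n≤′J) =
    trans (factor-trivial (2 ^ J) (partialT J) n
            (≤-<-trans (≤′⇒≤ n≤′J) (n<2^n J)))
          (go n≤′J)

largest : ∀ {p} {P : Pred ℕ p} → Decidable P → ℕ → ℕ
largest P? zero    = zero
largest P? (suc b) = if does (P? (suc b)) then suc b else largest P? b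

-- ℕ ⁺ is ℕ with a top element ⊤⁺ = +∞.  For n ≠ 0, the bound loses
-- nothing: 2 ^ v ∣ n forces v < 2 ^ v ≤ n.

ν₂ℕ : ℕ → ℕ ⁺
ν₂ℕ zero      = ⊤⁺
ν₂ℕ n@(suc _) = [ largest (λ v → 2 ^ v ∣? n) n ]

ν₂ : ℤ → ℕ ⁺
ν₂ a = ν₂ℕ ∣ a ∣

private
  largest-satisfies : ∀ {p} {P : Pred ℕ p} (P? : Decidable P) b →
                      P 0 → P (largest P? b)
  largest-satisfies P? zero    p₀ = p₀
  largest-satisfies P? (suc b) p₀ with P? (suc b)
  ... | yes p = p
  ... | no  _ = largest-satisfies P? b p₀

  largest-maximal : ∀ {p} {P : Pred ℕ p} (P? : Decidable P) b {v} →
                    P v → v ≤ b → v ≤ largest P? b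
  largest-maximal P? zero    _ v≤0 = v≤0
  largest-maximal P? (suc b) {v} pv v≤1+b with P? (suc b)
  ... | yes _ = v≤1+b
  ... | no ¬p with v ≟ suc b
  ...   | yes refl  = contradiction pv ¬p
  ...   | no  v≢1+b = largest-maximal P? b pv (≤-pred (≤∧≢⇒< v≤1+b v≢1+b))

ν₂ℕ-divides : ∀ n {v} → ν₂ℕ n ≡ [ v ] → 2 ^ v ∣ n
ν₂ℕ-divides n@(suc _) refl = largest-satisfies (λ v → 2 ^ v ∣? n) n (1∣ n)

ν₂ℕ-maximal : ∀ n {v w} → ν₂ℕ n ≡ [ v ] → 2 ^ w ∣ n → w ≤ v
ν₂ℕ-maximal n@(suc _) {w = w} refl 2^w∣n =
  largest-maximal (λ v → 2 ^ v ∣? n) n 2^w∣n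
    (<⇒≤ (<-≤-trans (n<2^n w) (∣⇒≤ 2^w∣n)))

-- The division by 2 ^ v is exact.

_/2^⁺_ : ℤ → ℕ ⁺ → ℤ
a /2^⁺ [ v ] = _/ℕ_ a (2 ^ v) {{m^n≢0 2 v}}
a /2^⁺ ⊤⁺    = 0ℤ

odd : ℤ → ℤ
odd a = a /2^⁺ ν₂ a

-- _%ℕ_ is the least nonnegative residue, also for negative a.

_mod2^_ : ℤ → (s : ℕ) → Fin (2 ^ s)
a mod2^ s = fromℕ< (n%ℕd<d a (2 ^ s) {{m^n≢0 2 s}})

record DFAO (A : Set) : Set where
  field
    size    : ℕ
    initial : Fin size
    step    : Fin size → Bit → Fin size
    output  : Fin size → A

  run : List Bit → A
  run w = output (foldl step initial w)

-- toDigits lists the least significant digit first; 0 has expansion "0".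

binary : ℕ → List Bit
binary n = reverse (proj₁ (toDigits 2 n))

2-Automatic : ∀ {k} → (ℕ → Fin k) → Set
2-Automatic {k} a = Σ[ M ∈ DFAO (Fin k) ] (∀ n → DFAO.run M (binary n) ≡ a n)

{-# OPTIONS --safe #-}

-- Put m = 2^r.  Both F = T^m and F = (1 - x)^(-m), whose coefficients are the
-- binomials of the theorem, satisfy F(x) = P(x) F(x²) with P = (1 + ε x)^m,
-- where ε = -1 and ε = 1 respectively.  Writing e P_e = m Q_e, every Q_e with
-- 1 ≤ e ≤ m is odd, and P is 1 + x^m modulo 2.  Let n = m q + c with 0 ≤ c < m.
-- If c = 0, then F_n is odd.  Otherwise the valuation of F_n is
-- r - ν₂(c) + ν₂(q + 1).  For even q this follows by reading
-- n F_n = Σ_k (n - 2k) P_{n-2k} F_k + 2 Σ_k P_{n-2k} k F_k modulo 2m: only the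
-- term k = m q / 2 of the first sum counts.  From q to 2q + 1 the coefficients
-- F_{mq+k}, 0 < k < m, are mapped linearly to the F_{m(2q+1)+c}, and after
-- division by the expected powers of 2 the map is still integral, and maps odd
-- vectors to odd vectors.  So the valuations do not depend on ε.
--
-- The same map, and exact division for even q, give odd (F_{mq+c}) modulo 2^s
-- from boundedly many residues of F near m q and of the odd parts for ⌊q/2⌋.
-- These residues are the states of the automaton.

module Submission where

open import Defs
open import Algebra.Bundles using (CommutativeMonoid)
import Algebra.Properties.CommutativeMonoid.Mult as Mult
import Algebra.Properties.CommutativeSemigroup as CommutativeSemigroupProperties
open import Data.Digit using (Bit; Expansion; fromDigits; toDigits)
open import Data.Fin.Base as Fin using (Fin; toℕ; fromℕ<; combine; remQuot; funToFin; finToFun)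
open import Data.Fin.Properties using (toℕ-fromℕ<; fromℕ<-cong; toℕ<n; remQuot-combine; finToFun-funToFin)
open import Data.Integer.Base as ℤ using (ℤ; +_; 0ℤ; 1ℤ; -1ℤ; _*_; ∣_∣; _/ℕ_; _%ℕ_)
  renaming (_+_ to _⊕_; _-_ to _⊖_)
import Data.Integer.DivMod as ℤ
open import Data.Integer.Divisibility.Signed as ℤ∣ using (divides) renaming (_∣_ to _∣ℤ_)
import Data.Integer.Properties as ℤ
open import Data.Integer.Tactic.RingSolver using (solve-∀)
open import Data.List.Base using ([]; _∷_; foldl; foldr; reverse)
open import Data.List.Properties using (reverse-foldl)
open import Data.Nat.Base as ℕ using (ℕ; zero; suc; z≤n; s≤s; _+_; _∸_; _^_; _≤_; _<_)
open import Data.Nat.Combinatorics using (_C_; nCk+nC[k+1]≡[n+1]C[k+1]; nCn≡1; nC1≡n; k>n⇒nCk≡0)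
import Data.Nat.Divisibility as ℕ∣
open import Data.Nat.DivMod using (_/_; _%_; m≡m%n+[m/n]*n; m%n<n)
open import Data.Nat.Induction using (<-rec)
import Data.Nat.Properties as ℕ
import Data.Nat.Tactic.RingSolver as ℕ-Solver
open import Data.Product.Base using (∃; _×_; _,_; proj₁; proj₂; map₂)
open import Data.Sum.Base using (_⊎_; inj₁; inj₂)
open import Function.Base using (_∘_; flip)
open import Level using (0ℓ)
open import Relation.Binary.Definitions using (tri<; tri≈; tri>)
open import Relation.Binary.PropositionalEquality
open import Relation.Nullary using (¬_; yes; no; contradiction; Dec)
open import Relation.Nullary.Construct.Add.Supremum using ([_])
open import Algebra.Properties.AbelianGroup ℤ.+-0-abelianGroup using (∙-cancelʳ)
open import Algebra.Properties.Semiring.Sum ℤ.+-*-semiring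
  using (sum; sum-cong-≗; sum-replicate-zero; ∑-distrib-+; *-distribˡ-sum)

-- The ring of power series and the equation F(x) = P(x) F(x²)

-- The formula for n F_n is the coefficient form of x F′(x) = m Q(x) F(x²) + 2 P(x) · x² F′(x²), as
-- x P′ = m Q. It settles even q only: for odd q no term Q_{n-2k} F_k is odd, and since ν₂(q + 1) is
-- unbounded, no fixed modulus can suffice. Hence the rescaled map from block q to block 2q + 1. Put
-- γ(k) = r - ν₂(k). The entry of the map at (c, k) is 2^(γ(k)-1) P_{m+c-2k} / 2^γ(c). Integrality
-- comes from multiplying by c: for e = m + c - 2k, the relation e P_e = m Q_e reads c P_e = 2k P_e
-- + m (Q_e - P_e), and the odd part of c can be cancelled. The same identity gives the parity of
-- the image. In the first term P_e is odd only for 2k = c and 2k = m + c, two contributions that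
-- are both absent or cancel modulo 2. The second term carries the factor 2^(γ(k)-1), which is odd
-- only for k = m/2, where Q_c - P_c is odd. So exactly one contribution survives, whichever odd
-- vector is mapped.

tail : Series → Series
tail f n = f (suc n)

infixr 7 _•_
_•_ : ℤ → Series → Series
(a • f) n = a * f n

infixl 6 _+ₛ_
_+ₛ_ : Series → Series → Series
(f +ₛ g) n = f n ⊕ g n

*ₛ-cong : ∀ {f f′ g g′} → f ≗ f′ → g ≗ g′ → f *ₛ g ≗ f′ *ₛ g′
*ₛ-cong p q n = sum-cong-≗ {suc n} λ i → cong₂ _*_ (p (toℕ i)) (q (n ∸ toℕ i))

-- The Cauchy product at `suc n` unfolds to `f 0 * g (suc n) ⊕ (tail f *ₛ g) n`. The ring laws are
-- therefore proved by induction on the exponent with `f` replaced by `tail f`, without reindexing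
-- double sums.
*ₛ-distribʳ : ∀ h f g → (f +ₛ g) *ₛ h ≗ f *ₛ h +ₛ g *ₛ h
*ₛ-distribʳ h f g zero    = lem (f 0) (g 0) (h 0)
  where
  lem : ∀ a b c → (a ⊕ b) * c ⊕ 0ℤ ≡ (a * c ⊕ 0ℤ) ⊕ (b * c ⊕ 0ℤ)
  lem = solve-∀
*ₛ-distribʳ h f g (suc n) =
  trans (cong (((f 0 ⊕ g 0) * h (suc n)) ⊕_) (*ₛ-distribʳ h (tail f) (tail g) n))
        (lem (f 0) (g 0) (h (suc n)) _ _)
  where
  lem : ∀ a b c x y → (a ⊕ b) * c ⊕ (x ⊕ y) ≡ (a * c ⊕ x) ⊕ (b * c ⊕ y)
  lem = solve-∀

•-*ₛ : ∀ a f g → (a • f) *ₛ g ≗ a • (f *ₛ g)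
•-*ₛ a f g zero    = lem a (f 0) (g 0)
  where
  lem : ∀ a x y → a * x * y ⊕ 0ℤ ≡ a * (x * y ⊕ 0ℤ)
  lem = solve-∀
•-*ₛ a f g (suc n) =
  trans (cong ((a * f 0 * g (suc n)) ⊕_) (•-*ₛ a (tail f) g n))
        (lem a (f 0) (g (suc n)) _)
  where
  lem : ∀ a x y z → a * x * y ⊕ a * z ≡ a * (x * y ⊕ z)
  lem = solve-∀

*ₛ-sucʳ : ∀ f g n → (f *ₛ g) (suc n) ≡ (f *ₛ tail g) n ⊕ f (suc n) * g 0
*ₛ-sucʳ f g zero    = lem (f 0) (g 0) (f 1) (g 1)
  where
  lem : ∀ a b c d → a * d ⊕ (c * b ⊕ 0ℤ) ≡ (a * d ⊕ 0ℤ) ⊕ c * b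
  lem = solve-∀
*ₛ-sucʳ f g (suc n) =
  trans (cong (f 0 * g (suc (suc n)) ⊕_) (*ₛ-sucʳ (tail f) g n))
        (sym (ℤ.+-assoc (f 0 * g (suc (suc n))) _ _))

*ₛ-comm : ∀ f g → f *ₛ g ≗ g *ₛ f
*ₛ-comm f g zero    = cong (_⊕ 0ℤ) (ℤ.*-comm (f 0) (g 0))
*ₛ-comm f g (suc n) = begin
  f 0 * g (suc n) ⊕ (tail f *ₛ g) n  ≡⟨ cong₂ _⊕_ (ℤ.*-comm (f 0) _) (*ₛ-comm (tail f) g n) ⟩
  g (suc n) * f 0 ⊕ (g *ₛ tail f) n  ≡⟨ ℤ.+-comm _ ((g *ₛ tail f) n) ⟩
  (g *ₛ tail f) n ⊕ g (suc n) * f 0  ≡⟨ *ₛ-sucʳ g f n ⟨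
  (g *ₛ f) (suc n)                   ∎
  where open ≡-Reasoning

*ₛ-assoc : ∀ f g h → (f *ₛ g) *ₛ h ≗ f *ₛ (g *ₛ h)
*ₛ-assoc f g h zero    = lem (f 0) (g 0) (h 0)
  where
  lem : ∀ a b c → (a * b ⊕ 0ℤ) * c ⊕ 0ℤ ≡ a * (b * c ⊕ 0ℤ) ⊕ 0ℤ
  lem = solve-∀
*ₛ-assoc f g h (suc n) = begin
  (f 0 * g 0 ⊕ 0ℤ) * h (suc n) ⊕ ((f 0 • tail g +ₛ tail f *ₛ g) *ₛ h) n
    ≡⟨ cong ((f 0 * g 0 ⊕ 0ℤ) * h (suc n) ⊕_) (*ₛ-distribʳ h (f 0 • tail g) (tail f *ₛ g) n) ⟩
  (f 0 * g 0 ⊕ 0ℤ) * h (suc n) ⊕ (((f 0 • tail g) *ₛ h) n ⊕ ((tail f *ₛ g) *ₛ h) n)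
    ≡⟨ cong₂ (λ x y → (f 0 * g 0 ⊕ 0ℤ) * h (suc n) ⊕ (x ⊕ y))
         (•-*ₛ (f 0) (tail g) h n) (*ₛ-assoc (tail f) g h n) ⟩
  (f 0 * g 0 ⊕ 0ℤ) * h (suc n) ⊕ (f 0 * (tail g *ₛ h) n ⊕ (tail f *ₛ (g *ₛ h)) n)
    ≡⟨ lem (f 0) (g 0) (h (suc n)) _ _ ⟩
  f 0 * (g 0 * h (suc n) ⊕ (tail g *ₛ h) n) ⊕ (tail f *ₛ (g *ₛ h)) n
    ∎
  where
  open ≡-Reasoning
  lem : ∀ a b c x y → (a * b ⊕ 0ℤ) * c ⊕ (a * x ⊕ y) ≡ a * (b * c ⊕ x) ⊕ y
  lem = solve-∀

zero-*ₛ : ∀ (f g : Series) → f ≗ (λ _ → 0ℤ) → f *ₛ g ≗ (λ _ → 0ℤ)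
zero-*ₛ f g f≗0 n =
  trans (sum-cong-≗ {suc n} λ i → trans (cong (_* g (n ∸ toℕ i)) (f≗0 (toℕ i))) (ℤ.*-zeroˡ (g (n ∸ toℕ i))))
        (sum-replicate-zero (suc n))

*ₛ-identityˡ : ∀ f → 1ₛ *ₛ f ≗ f
*ₛ-identityˡ f zero    = trans (ℤ.+-identityʳ _) (ℤ.*-identityˡ (f 0))
*ₛ-identityˡ f (suc n) = begin
  1ℤ * f (suc n) ⊕ (tail 1ₛ *ₛ f) n  ≡⟨ cong₂ _⊕_ (ℤ.*-identityˡ (f (suc n))) (zero-*ₛ (tail 1ₛ) f (λ _ → refl) n) ⟩
  f (suc n) ⊕ 0ℤ                     ≡⟨ ℤ.+-identityʳ (f (suc n)) ⟩
  f (suc n)                          ∎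
  where open ≡-Reasoning

*ₛ-commutativeMonoid : CommutativeMonoid 0ℓ 0ℓ
*ₛ-commutativeMonoid = record
  { Carrier = Series ; _≈_ = _≗_ ; _∙_ = _*ₛ_ ; ε = 1ₛ
  ; isCommutativeMonoid = record
    { isMonoid = record
      { isSemigroup = record
        { isMagma = record
          { isEquivalence = record
            { refl = λ _ → refl ; sym = λ p n → sym (p n) ; trans = λ p q n → trans (p n) (q n) }
          ; ∙-cong = *ₛ-cong }
        ; assoc = *ₛ-assoc }
      ; identity = *ₛ-identityˡ , λ f n → trans (*ₛ-comm f 1ₛ n) (*ₛ-identityˡ f n) }
    ; comm = *ₛ-comm } }

module Pow = Mult *ₛ-commutativeMonoid

-- Multiples in the monoid of series under `*ₛ` are powers, so `×-distrib-+` becomes (fg)^m = f^m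
-- g^m.
^ₛ≗× : ∀ f m → f ^ₛ m ≗ m Pow.× f
^ₛ≗× f zero    n = refl
^ₛ≗× f (suc m) n = *ₛ-cong {f} (λ _ → refl) (^ₛ≗× f m) n

^ₛ-cong : ∀ {f g} m → f ≗ g → f ^ₛ m ≗ g ^ₛ m
^ₛ-cong zero    p n = refl
^ₛ-cong (suc m) p n = *ₛ-cong p (^ₛ-cong m p) n

^ₛ-distrib-*ₛ : ∀ f g m → (f *ₛ g) ^ₛ m ≗ f ^ₛ m *ₛ g ^ₛ m
^ₛ-distrib-*ₛ f g m n = begin
  ((f *ₛ g) ^ₛ m) n                  ≡⟨ ^ₛ≗× (f *ₛ g) m n ⟩
  (m Pow.× (f *ₛ g)) n               ≡⟨ Pow.×-distrib-+ f g m n ⟩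
  ((m Pow.× f) *ₛ (m Pow.× g)) n     ≡⟨ *ₛ-cong (^ₛ≗× f m) (^ₛ≗× g m) n ⟨
  (f ^ₛ m *ₛ g ^ₛ m) n               ∎
  where open ≡-Reasoning

-- f(x) ↦ f(x²)
dilate : Series → Series
dilate f zero          = f 0
dilate f (suc zero)    = 0ℤ
dilate f (suc (suc n)) = dilate (tail f) n

dilate-cong : ∀ {f g} n → (∀ k → k ≤ n → f k ≡ g k) → dilate f n ≡ dilate g n
dilate-cong zero          p = p 0 z≤n
dilate-cong (suc zero)    p = refl
dilate-cong (suc (suc n)) p = dilate-cong n (λ k k≤n → p (suc k) (s≤s (ℕ.≤-trans k≤n (ℕ.n≤1+n n))))

dilate-linear : ∀ a f g → dilate (a • f +ₛ g) ≗ a • dilate f +ₛ dilate g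
dilate-linear a f g zero          = refl
dilate-linear a f g (suc zero)    = sym (trans (ℤ.+-identityʳ _) (ℤ.*-zeroʳ a))
dilate-linear a f g (suc (suc n)) = dilate-linear a (tail f) (tail g) n

dilate-*ₛ : ∀ f g → dilate (f *ₛ g) ≗ dilate f *ₛ dilate g
dilate-*ₛ f g zero          = refl
dilate-*ₛ f g (suc zero)    = lem (f 0) (g 0)
  where
  lem : ∀ a b → 0ℤ ≡ a * 0ℤ ⊕ (0ℤ * b ⊕ 0ℤ)
  lem = solve-∀
dilate-*ₛ f g (suc (suc n)) = begin
  dilate (f 0 • tail g +ₛ tail f *ₛ g) n
    ≡⟨ dilate-linear (f 0) (tail g) (tail f *ₛ g) n ⟩
  f 0 * dilate (tail g) n ⊕ dilate (tail f *ₛ g) n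
    ≡⟨ cong (f 0 * dilate (tail g) n ⊕_) (dilate-*ₛ (tail f) g n) ⟩
  f 0 * dilate (tail g) n ⊕ (dilate (tail f) *ₛ dilate g) n
    ≡⟨ lem (f 0 * dilate (tail g) n) (dilate g (suc n)) ((dilate (tail f) *ₛ dilate g) n) ⟩
  f 0 * dilate (tail g) n ⊕ (0ℤ * dilate g (suc n) ⊕ (dilate (tail f) *ₛ dilate g) n)
    ∎
  where
  open ≡-Reasoning
  lem : ∀ x y z → x ⊕ z ≡ x ⊕ (0ℤ * y ⊕ z)
  lem = solve-∀

dilate-1ₛ : dilate 1ₛ ≗ 1ₛ
dilate-1ₛ zero          = refl
dilate-1ₛ (suc zero)    = refl
dilate-1ₛ (suc (suc n)) = dilate-0 n
  where
  dilate-0 : dilate (λ _ → 0ℤ) ≗ λ _ → 0ℤ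
  dilate-0 zero          = refl
  dilate-0 (suc zero)    = refl
  dilate-0 (suc (suc n)) = dilate-0 n

dilate-^ₛ : ∀ f m → dilate (f ^ₛ m) ≗ dilate f ^ₛ m
dilate-^ₛ f zero    n = dilate-1ₛ n
dilate-^ₛ f (suc m) n =
  trans (dilate-*ₛ f (f ^ₛ m) n) (*ₛ-cong {dilate f} (λ _ → refl) (dilate-^ₛ f m) n)

dilate-X : ∀ k → dilate (X^ k) ≗ X^ (k + k)
dilate-X zero    n = dilate-1ₛ n
dilate-X (suc k) n rewrite ℕ.+-suc k k = go n
  where
  go : ∀ n → dilate (X^ suc k) n ≡ (X^ (suc (suc (k + k)))) n
  go zero          = refl
  go (suc zero)    = refl
  go (suc (suc n)) = dilate-X k n

-- 1 + ε x
linear : ℤ → Series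
linear ε zero          = 1ℤ
linear ε (suc zero)    = ε
linear ε (suc (suc _)) = 0ℤ

linear-*ₛ-zero : ∀ ε f → (linear ε *ₛ f) 0 ≡ f 0
linear-*ₛ-zero ε f = trans (ℤ.+-identityʳ _) (ℤ.*-identityˡ (f 0))

linear-*ₛ-suc : ∀ ε f n → (linear ε *ₛ f) (suc n) ≡ f (suc n) ⊕ ε * f n
linear-*ₛ-suc ε f n = cong₂ _⊕_ (ℤ.*-identityˡ (f (suc n))) (go n)
  where
  go : ∀ n → (tail (linear ε) *ₛ f) n ≡ ε * f n
  go zero    = ℤ.+-identityʳ _
  go (suc n) = trans (cong (ε * f (suc n) ⊕_) (zero-*ₛ _ f (λ _ → refl) n)) (ℤ.+-identityʳ _)

1-X≗linear : 1ₛ -ₛ X^ 1 ≗ linear -1ℤ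
1-X≗linear zero          = refl
1-X≗linear (suc zero)    = refl
1-X≗linear (suc (suc n)) = refl

-- `partialT` grows by the factor of largest exponent, whereas here the smallest one, 1 - x, is
-- split off. In the induction the new factor is the dilation of the factor that leads from
-- `partialT J` to `partialT (suc J)`, and it commutes past 1 - x.
partialT-suc : ∀ J → partialT (suc J) ≗ linear -1ℤ *ₛ dilate (partialT J)
partialT-suc zero    n = *ₛ-cong 1-X≗linear (λ i → sym (dilate-1ₛ i)) n
partialT-suc (suc J) n = begin
  ((1ₛ -ₛ X^ 2^J+1) *ₛ partialT (suc J)) n
    ≡⟨ *ₛ-cong factor (partialT-suc J) n ⟩
  (dilate 1-X^2^J *ₛ (linear -1ℤ *ₛ dilate (partialT J))) n
    ≡⟨ x∙yz≈y∙xz (dilate 1-X^2^J) (linear -1ℤ) (dilate (partialT J)) n ⟩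
  (linear -1ℤ *ₛ (dilate 1-X^2^J *ₛ dilate (partialT J))) n
    ≡⟨ *ₛ-cong {linear -1ℤ} (λ _ → refl) (dilate-*ₛ 1-X^2^J (partialT J)) n ⟨
  (linear -1ℤ *ₛ dilate (partialT (suc J))) n
    ∎
  where
  open ≡-Reasoning
  open CommutativeSemigroupProperties (CommutativeMonoid.commutativeSemigroup *ₛ-commutativeMonoid)
  2^J+1 = 2 ^ suc J
  1-X^2^J = 1ₛ -ₛ X^ (2 ^ J)
  factor : 1ₛ -ₛ X^ 2^J+1 ≗ dilate 1-X^2^J
  factor n = begin
    1ₛ n ⊖ (X^ 2^J+1) n
      ≡⟨ cong₂ _⊖_ (sym (dilate-1ₛ n)) (sym (trans (dilate-X (2 ^ J) n) (cong (λ k → (X^ k) n) 2^J+2^J))) ⟩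
    dilate 1ₛ n ⊖ dilate (X^ (2 ^ J)) n
      ≡⟨ lem (dilate 1ₛ n) (dilate (X^ (2 ^ J)) n) ⟩
    -1ℤ * dilate (X^ (2 ^ J)) n ⊕ dilate 1ₛ n
      ≡⟨ dilate-linear -1ℤ (X^ (2 ^ J)) 1ₛ n ⟨
    dilate (-1ℤ • X^ (2 ^ J) +ₛ 1ₛ) n
      ≡⟨ dilate-cong n (λ k _ → sym (lem (1ₛ k) ((X^ (2 ^ J)) k))) ⟩
    dilate 1-X^2^J n ∎
    where
    lem : ∀ a b → a ⊖ b ≡ -1ℤ * b ⊕ a
    lem = solve-∀
    2^J+2^J : 2 ^ J + 2 ^ J ≡ 2^J+1
    2^J+2^J = cong (ℕ._+_ (2 ^ J)) (sym (ℕ.+-identityʳ (2 ^ J)))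

linear-*ₛ-cong : ∀ {f g} ε n → (∀ k → k ≤ n → f k ≡ g k) → (linear ε *ₛ f) n ≡ (linear ε *ₛ g) n
linear-*ₛ-cong {f} {g} ε zero p = cong (λ a → 1ℤ * a ⊕ 0ℤ) (p 0 z≤n)
linear-*ₛ-cong {f} {g} ε (suc n) p = begin
  (linear ε *ₛ f) (suc n)  ≡⟨ linear-*ₛ-suc ε f n ⟩
  f (suc n) ⊕ ε * f n      ≡⟨ cong₂ (λ a b → a ⊕ ε * b) (p (suc n) ℕ.≤-refl) (p n (ℕ.n≤1+n n)) ⟩
  g (suc n) ⊕ ε * g n      ≡⟨ linear-*ₛ-suc ε g n ⟨
  (linear ε *ₛ g) (suc n)  ∎
  where open ≡-Reasoning

-- Coefficient n of the right-hand side involves only coefficients of `T` up to n, and on these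
-- `partialT n` has already stabilised.
T-equation : T ≗ linear -1ℤ *ₛ dilate T
T-equation n = begin
  T n                                     ≡⟨ T-limit (ℕ.n≤1+n n) ⟨
  partialT (suc n) n                      ≡⟨ partialT-suc n n ⟩
  (linear -1ℤ *ₛ dilate (partialT n)) n   ≡⟨ linear-*ₛ-cong -1ℤ n (λ k k≤n → dilate-cong k λ i i≤k →
                                               T-limit (ℕ.≤-trans i≤k k≤n)) ⟩
  (linear -1ℤ *ₛ dilate T) n              ∎
  where open ≡-Reasoning

-- 1 / (1 - x)
geometric : Series
geometric _ = 1ℤ

geometric-equation : geometric ≗ linear 1ℤ *ₛ dilate geometric
geometric-equation zero    = refl
geometric-equation (suc n) = sym (trans (linear-*ₛ-suc 1ℤ (dilate geometric) n) (go n))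
  where
  go : ∀ n → dilate geometric (suc n) ⊕ 1ℤ * dilate geometric n ≡ 1ℤ
  go zero          = refl
  go (suc zero)    = refl
  go (suc (suc n)) = go n

^ₛ-equation : ∀ {f a} → f ≗ a *ₛ dilate f → ∀ m → f ^ₛ m ≗ a ^ₛ m *ₛ dilate (f ^ₛ m)
^ₛ-equation {f} {a} eq m n = begin
  (f ^ₛ m) n                         ≡⟨ ^ₛ-cong m eq n ⟩
  ((a *ₛ dilate f) ^ₛ m) n           ≡⟨ ^ₛ-distrib-*ₛ a (dilate f) m n ⟩
  (a ^ₛ m *ₛ dilate f ^ₛ m) n        ≡⟨ *ₛ-cong {a ^ₛ m} (λ _ → refl) (dilate-^ₛ f m) n ⟨
  (a ^ₛ m *ₛ dilate (f ^ₛ m)) n      ∎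
  where open ≡-Reasoning

linear-^ₛ : ∀ ε m e → (linear ε ^ₛ m) e ≡ ε ℤ.^ e * + (m C e)
linear-^ₛ ε zero    zero    = refl
linear-^ₛ ε zero    (suc e) = sym (ℤ.*-zeroʳ (ε ℤ.^ suc e))
linear-^ₛ ε (suc m) zero    = trans (linear-*ₛ-zero ε (linear ε ^ₛ m)) (linear-^ₛ ε m zero)
linear-^ₛ ε (suc m) (suc e) = begin
  (linear ε ^ₛ suc m) (suc e)
    ≡⟨ linear-*ₛ-suc ε (linear ε ^ₛ m) e ⟩
  (linear ε ^ₛ m) (suc e) ⊕ ε * (linear ε ^ₛ m) e
    ≡⟨ cong₂ (λ a b → a ⊕ ε * b) (linear-^ₛ ε m (suc e)) (linear-^ₛ ε m e) ⟩
  ε * ε ℤ.^ e * + (m C suc e) ⊕ ε * (ε ℤ.^ e * + (m C e))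
    ≡⟨ lem ε (ε ℤ.^ e) (+ (m C e)) (+ (m C suc e)) ⟩
  ε * ε ℤ.^ e * (+ (m C e) ⊕ + (m C suc e))
    ≡⟨ cong (λ k → ε * ε ℤ.^ e * + k) (nCk+nC[k+1]≡[n+1]C[k+1] m e) ⟩
  ε * ε ℤ.^ e * + (suc m C suc e) ∎
  where
  open ≡-Reasoning
  lem : ∀ ε a x y → ε * a * y ⊕ ε * (a * x) ≡ ε * a * (x ⊕ y)
  lem = solve-∀

geometric-*ₛ-suc : ∀ f n → (geometric *ₛ f) (suc n) ≡ f (suc n) ⊕ (geometric *ₛ f) n
geometric-*ₛ-suc f n = cong (_⊕ (geometric *ₛ f) n) (ℤ.*-identityˡ (f (suc n)))

-- Multiplication by `geometric` forms partial sums, so both sides obey Pascal's rule. This ties the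
-- binomial of the theorem to (1 - x)^(-m).
geometric-^ₛ : ∀ m n → (geometric ^ₛ suc m) n ≡ + ((n + m) C m)
geometric-^ₛ zero n = trans (*ₛ-comm geometric 1ₛ n) (*ₛ-identityˡ geometric n)
geometric-^ₛ (suc m) zero = begin
  1ℤ * (geometric ^ₛ suc m) 0 ⊕ 0ℤ  ≡⟨ ℤ.+-identityʳ _ ⟩
  1ℤ * (geometric ^ₛ suc m) 0       ≡⟨ ℤ.*-identityˡ _ ⟩
  (geometric ^ₛ suc m) 0            ≡⟨ geometric-^ₛ m 0 ⟩
  + (m C m)                         ≡⟨ cong +_ (trans (nCn≡1 m) (sym (nCn≡1 (suc m)))) ⟩
  + (suc m C suc m)                 ∎
  where open ≡-Reasoning
geometric-^ₛ (suc m) (suc n) = begin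
  (geometric ^ₛ suc (suc m)) (suc n)
    ≡⟨ geometric-*ₛ-suc (geometric ^ₛ suc m) n ⟩
  (geometric ^ₛ suc m) (suc n) ⊕ (geometric ^ₛ suc (suc m)) n
    ≡⟨ cong₂ _⊕_ (geometric-^ₛ m (suc n)) (geometric-^ₛ (suc m) n) ⟩
  + ((suc n + m) C m) ⊕ + ((n + suc m) C suc m)
    ≡⟨ cong (λ k → + (k C m) ⊕ + ((n + suc m) C suc m)) (sym (ℕ.+-suc n m)) ⟩
  + ((n + suc m) C m) ⊕ + ((n + suc m) C suc m)
    ≡⟨ cong +_ (nCk+nC[k+1]≡[n+1]C[k+1] (n + suc m) m) ⟩
  + (suc (n + suc m) C suc m) ∎
  where open ≡-Reasoning

-- Sums, parity and divisibility by powers of 2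

Σ< : ℕ → (ℕ → ℤ) → ℤ
Σ< n f = sum {n} (f ∘ toℕ)

module _ {f g : ℕ → ℤ} where

  Σ-cong : ∀ n → (∀ k → k < n → f k ≡ g k) → Σ< n f ≡ Σ< n g
  Σ-cong n p = sum-cong-≗ {n} λ i → p (toℕ i) (toℕ<n i)

  Σ-distrib-+ : ∀ n → Σ< n (λ k → f k ⊕ g k) ≡ Σ< n f ⊕ Σ< n g
  Σ-distrib-+ n = ∑-distrib-+ {n} (f ∘ toℕ) (g ∘ toℕ)

Σ-zero : ∀ {f} n → (∀ k → k < n → f k ≡ 0ℤ) → Σ< n f ≡ 0ℤ
Σ-zero n p = trans (Σ-cong n p) (sum-replicate-zero n)

Σ-*ˡ : ∀ f n a → a * Σ< n f ≡ Σ< n (λ k → a * f k)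
Σ-*ˡ f n a = *-distribˡ-sum {n} a (f ∘ toℕ)

Σ-drop : ∀ {f} b n → (∀ k → k < b → f k ≡ 0ℤ) → Σ< (b + n) f ≡ Σ< n (λ k → f (b + k))
Σ-drop zero    n p = refl
Σ-drop {f} (suc b) n p = begin
  f 0 ⊕ Σ< (b + n) (f ∘ suc)      ≡⟨ cong₂ _⊕_ (p 0 (s≤s z≤n)) (Σ-drop b n λ k k<b → p (suc k) (s≤s k<b)) ⟩
  0ℤ ⊕ Σ< n (λ k → f (suc b + k)) ≡⟨ ℤ.+-identityˡ _ ⟩
  Σ< n (λ k → f (suc b + k))      ∎
  where open ≡-Reasoning

Σ-∣ : ∀ {f d} n → (∀ k → k < n → d ∣ℤ f k) → d ∣ℤ Σ< n f
Σ-∣ {d = d} zero p = divides 0ℤ refl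
Σ-∣ (suc n) p = ℤ∣.∣m∣n⇒∣m+n (p 0 (s≤s z≤n)) (Σ-∣ n λ k k<n → p (suc k) (s≤s k<n))

Even : ℤ → Set
Even a = + 2 ∣ℤ a

record Odd (a : ℤ) : Set where
  constructor odd⁺
  field
    1+a-even : Even (1ℤ ⊕ a)

odd-1 : Odd 1ℤ
odd-1 = odd⁺ (divides 1ℤ refl)

even+odd : ∀ {a b} → Even a → Odd b → Odd (a ⊕ b)
even+odd {a} {b} (divides p refl) (odd⁺ (divides q e)) = odd⁺ (divides (p ⊕ q) (begin
  1ℤ ⊕ (p * + 2 ⊕ b)   ≡⟨ lem (p * + 2) b ⟩
  p * + 2 ⊕ (1ℤ ⊕ b)   ≡⟨ cong (p * + 2 ⊕_) e ⟩
  p * + 2 ⊕ q * + 2    ≡⟨ ℤ.*-distribʳ-+ (+ 2) p q ⟨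
  (p ⊕ q) * + 2        ∎))
  where
  open ≡-Reasoning
  lem : ∀ a b → 1ℤ ⊕ (a ⊕ b) ≡ a ⊕ (1ℤ ⊕ b)
  lem = solve-∀

odd+even : ∀ {a b} → Odd a → Even b → Odd (a ⊕ b)
odd+even {a} {b} p q = subst Odd (ℤ.+-comm b a) (even+odd q p)

odd+odd : ∀ {a b} → Odd a → Odd b → Even (a ⊕ b)
odd+odd {a} {b} (odd⁺ (divides p e)) (odd⁺ (divides q e′)) = divides (p ⊕ q ⊖ 1ℤ) (begin
  a ⊕ b                               ≡⟨ lem a b ⟩
  (1ℤ ⊕ a) ⊕ (1ℤ ⊕ b) ⊖ + 2           ≡⟨ cong₂ (λ x y → x ⊕ y ⊖ + 2) e e′ ⟩
  p * + 2 ⊕ q * + 2 ⊖ + 2             ≡⟨ lem₂ p q ⟩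
  (p ⊕ q ⊖ 1ℤ) * + 2                  ∎)
  where
  open ≡-Reasoning
  lem : ∀ a b → a ⊕ b ≡ (1ℤ ⊕ a) ⊕ (1ℤ ⊕ b) ⊖ + 2
  lem = solve-∀
  lem₂ : ∀ p q → p * + 2 ⊕ q * + 2 ⊖ + 2 ≡ (p ⊕ q ⊖ 1ℤ) * + 2
  lem₂ = solve-∀

odd*odd : ∀ {a b} → Odd a → Odd b → Odd (a * b)
odd*odd {a} {b} (odd⁺ (divides p e)) (odd⁺ (divides q e′)) = odd⁺ (divides (+ 2 * p * q ⊖ p ⊖ q ⊕ 1ℤ) (begin
  1ℤ ⊕ a * b                                          ≡⟨ lem a b ⟩
  (1ℤ ⊕ a) * (1ℤ ⊕ b) ⊖ (1ℤ ⊕ a) ⊖ (1ℤ ⊕ b) ⊕ + 2     ≡⟨ cong₂ (λ x y → x * y ⊖ x ⊖ y ⊕ + 2) e e′ ⟩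
  p * + 2 * (q * + 2) ⊖ p * + 2 ⊖ q * + 2 ⊕ + 2       ≡⟨ lem₂ p q ⟩
  (+ 2 * p * q ⊖ p ⊖ q ⊕ 1ℤ) * + 2                    ∎))
  where
  open ≡-Reasoning
  lem : ∀ a b → 1ℤ ⊕ a * b ≡ (1ℤ ⊕ a) * (1ℤ ⊕ b) ⊖ (1ℤ ⊕ a) ⊖ (1ℤ ⊕ b) ⊕ + 2
  lem = solve-∀
  lem₂ : ∀ p q → p * + 2 * (q * + 2) ⊖ p * + 2 ⊖ q * + 2 ⊕ + 2 ≡ (+ 2 * p * q ⊖ p ⊖ q ⊕ 1ℤ) * + 2
  lem₂ = solve-∀

even*ˡ : ∀ {a} b → Even a → Even (a * b)
even*ˡ {a} b = ℤ∣.∣m⇒∣m*n b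

even*ʳ : ∀ a {b} → Even b → Even (a * b)
even*ʳ = ℤ∣.∣n⇒∣m*n

even+even : ∀ {a b} → Even a → Even b → Even (a ⊕ b)
even+even = ℤ∣.∣m∣n⇒∣m+n

even-neg : ∀ {a} → Even a → Even (ℤ.- a)
even-neg = ℤ∣.∣m⇒∣-m

even∧odd⇒⊥ : ∀ {a} → Even a → ¬ Odd a
even∧odd⇒⊥ p (odd⁺ q) = 2∤1 (ℤ∣.∣m+n∣n⇒∣m q p)
  where
  2∤1 : ¬ Even 1ℤ
  2∤1 2∣1 with ℤ∣.∣⇒∣ᵤ 2∣1
  ... | d with Data.Nat.Divisibility.∣⇒≤ d
    where import Data.Nat.Divisibility
  ... | s≤s ()

even⊎odd : ∀ a → Even a ⊎ Odd a
even⊎odd a with a ℤ.%ℕ 2 in e | Data.Integer.DivMod.n%ℕd<d a 2 | Data.Integer.DivMod.a≡a%ℕn+[a/ℕn]*n a 2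
  where import Data.Integer.DivMod
... | 0 | _ | eq = inj₁ (divides (a ℤ./ℕ 2) (trans eq (ℤ.+-identityˡ _)))
... | 1 | _ | eq = inj₂ (subst Odd (sym eq) (odd+even odd-1 (divides (a ℤ./ℕ 2) refl)))
... | suc (suc _) | s≤s (s≤s ()) | _

odd-*⁻ʳ : ∀ {a b} → Odd (a * b) → Odd b
odd-*⁻ʳ {a} {b} o with even⊎odd b
... | inj₁ e = contradiction o (even∧odd⇒⊥ (even*ʳ a e))
... | inj₂ o = o

even-*⁻ʳ : ∀ {a b} → Odd a → Even (a * b) → Even b
even-*⁻ʳ {a} {b} o e with even⊎odd b
... | inj₁ e = e
... | inj₂ o′ = contradiction (odd*odd o o′) (even∧odd⇒⊥ e)

pos-2^suc : ∀ i → + (2 ^ suc i) ≡ + 2 * + (2 ^ i)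
pos-2^suc i = ℤ.pos-* 2 (2 ^ i)

-- Coprimality of `a` and 2^i, used one factor 2 at a time. Both conclusions matter later: the first
-- divides a coefficient by its expected power of 2, the second lets the parity of the quotient be
-- read off from `z`.
odd-cancel-2^ : ∀ {a} → Odd a → ∀ i z x → + (2 ^ i) * z ≡ a * x → ∃ λ y → x ≡ + (2 ^ i) * y × z ≡ a * y
odd-cancel-2^ {a} o zero z x e = x , sym (ℤ.*-identityˡ x) , trans (sym (ℤ.*-identityˡ z)) e
odd-cancel-2^ {a} o (suc i) z x e
  with even-*⁻ʳ {a} {x} o (divides (+ (2 ^ i) * z)
         (trans (sym e) (trans (cong (_* z) (pos-2^suc i)) (lem (+ (2 ^ i)) z))))
  where
  lem : ∀ p z → + 2 * p * z ≡ p * z * + 2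
  lem = solve-∀
... | divides x′ refl with odd-cancel-2^ o i z x′ (ℤ.*-cancelˡ-≡ (+ 2) _ _ (begin
    + 2 * (+ (2 ^ i) * z)   ≡⟨ ℤ.*-assoc (+ 2) (+ (2 ^ i)) z ⟨
    + 2 * + (2 ^ i) * z     ≡⟨ cong (_* z) (pos-2^suc i) ⟨
    + (2 ^ suc i) * z       ≡⟨ e ⟩
    a * (x′ * + 2)          ≡⟨ lem a x′ ⟩
    + 2 * (a * x′)          ∎))
  where
  open ≡-Reasoning
  lem : ∀ a x → a * (x * + 2) ≡ + 2 * (a * x)
  lem = solve-∀
... | y , refl , z≡ = y , trans (lem (+ (2 ^ i)) y) (cong (_* y) (sym (pos-2^suc i))) , z≡
  where
  lem : ∀ p y → p * y * + 2 ≡ + 2 * p * y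
  lem = solve-∀

Σ-odd : ∀ {f} n k₀ → k₀ < n → Odd (f k₀) → (∀ k → k < n → k ≢ k₀ → Even (f k)) → Odd (Σ< n f)
Σ-odd (suc n) zero    _          o e = odd+even o (Σ-∣ n λ k k<n → e (suc k) (s≤s k<n) λ ())
Σ-odd (suc n) (suc k₀) (s≤s k₀<n) o e =
  even+odd (e 0 (s≤s z≤n) λ ())
           (Σ-odd n k₀ k₀<n o λ k k<n k≢k₀ → e (suc k) (s≤s k<n) (k≢k₀ ∘ ℕ.suc-injective))

Σ-odd₂ : ∀ {f} n k₁ k₂ → k₁ < k₂ → k₂ < n → Odd (f k₁) → Odd (f k₂) →
         (∀ k → k < n → k ≢ k₁ → k ≢ k₂ → Even (f k)) → Even (Σ< n f)
Σ-odd₂ (suc n) zero (suc k₂) _ (s≤s k₂<n) o₁ o₂ e =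
  odd+odd o₁ (Σ-odd n k₂ k₂<n o₂ λ k k<n k≢k₂ → e (suc k) (s≤s k<n) (λ ()) (k≢k₂ ∘ ℕ.suc-injective))
Σ-odd₂ (suc n) (suc k₁) (suc k₂) (s≤s k₁<k₂) (s≤s k₂<n) o₁ o₂ e =
  even+even (e 0 (s≤s z≤n) (λ ()) (λ ()))
    (Σ-odd₂ n k₁ k₂ k₁<k₂ k₂<n o₁ o₂ λ k k<n k≢k₁ k≢k₂ →
      e (suc k) (s≤s k<n) (k≢k₁ ∘ ℕ.suc-injective) (k≢k₂ ∘ ℕ.suc-injective))

-- at f x y is the coefficient of f at x - y, which is 0 for x < y.
at : Series → ℕ → ℕ → ℤ
at f x       zero    = f x
at f zero    (suc y) = 0ℤ
at f (suc x) (suc y) = at f x y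

module _ (f : Series) where

  at-+ˡ : ∀ z x y → at f (z + x) (z + y) ≡ at f x y
  at-+ˡ zero    x y = refl
  at-+ˡ (suc z) x y = at-+ˡ z x y

  at-shift : ∀ {x y x′ y′} → x + y′ ≡ x′ + y → at f x y ≡ at f x′ y′
  at-shift {x} {y} {x′} {y′} e = begin
    at f x y                 ≡⟨ at-+ˡ y′ x y ⟨
    at f (y′ + x) (y′ + y)   ≡⟨ cong₂ (at f) (trans (ℕ.+-comm y′ x) (trans e (ℕ.+-comm x′ y))) (ℕ.+-comm y′ y) ⟩
    at f (y + x′) (y + y′)   ≡⟨ at-+ˡ y x′ y′ ⟩
    at f x′ y′               ∎
    where open ≡-Reasoning

  at-neg : ∀ {x y} → x < y → at f x y ≡ 0ℤ
  at-neg {zero}  {suc y} _         = refl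
  at-neg {suc x} {suc y} (s≤s x<y) = at-neg x<y

  at-nonneg : ∀ y e → at f (y + e) y ≡ f e
  at-nonneg zero    e = refl
  at-nonneg (suc y) e = at-nonneg y e

  at-large : ∀ {d} → (∀ e → d < e → f e ≡ 0ℤ) → ∀ {x y} → y + d < x → at f x y ≡ 0ℤ
  at-large z {x}     {zero}  d<x         = z x d<x
  at-large z {suc x} {suc y} (s≤s y+d<x) = at-large z y+d<x

-- The coefficient form of f(x) = P(x) f(x²). Terms with 2k > n vanish, so every K with n < 2K is
-- allowed and each use can choose a convenient range.
Refinable : Series → Series → Set
Refinable P f = ∀ n K → n < K + K → f n ≡ Σ< K (λ k → at P n (k + k) * f k)

dilate-*ₛ-Σ : ∀ f P n K → n < K + K → (dilate f *ₛ P) n ≡ Σ< K (λ k → at P n (k + k) * f k)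
dilate-*ₛ-Σ f P zero (suc K) _ =
  cong₂ _⊕_ (ℤ.*-comm (f 0) (P 0)) (sym (Σ-zero K λ k _ → refl))
dilate-*ₛ-Σ f P (suc zero) (suc K) _ =
  cong₂ _⊕_ (ℤ.*-comm (f 0) (P 1)) (trans (lem (P 0)) (sym (Σ-zero K λ k _ → vanish k)))
  where
  lem : ∀ a → 0ℤ * a ⊕ 0ℤ ≡ 0ℤ
  lem = solve-∀
  vanish : ∀ k → at P 0 (k + suc k) * f (suc k) ≡ 0ℤ
  vanish k = cong (_* f (suc k)) (at-neg P {0} {k + suc k} (ℕ.≤-trans (s≤s z≤n) (ℕ.m≤n+m (suc k) k)))
dilate-*ₛ-Σ f P (suc (suc n)) (suc K) (s≤s n<) = cong₂ _⊕_ (ℤ.*-comm (f 0) (P (suc (suc n)))) (begin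
  0ℤ * P (suc n) ⊕ (dilate (tail f) *ₛ P) n
    ≡⟨ lem (P (suc n)) _ ⟩
  (dilate (tail f) *ₛ P) n
    ≡⟨ dilate-*ₛ-Σ (tail f) P n K (ℕ.≤-pred (subst (suc n <_) (ℕ.+-suc K K) n<)) ⟩
  Σ< K (λ k → at P n (k + k) * f (suc k))
    ≡⟨ Σ-cong K (λ k _ → cong (λ y → at P (suc n) y * f (suc k)) (sym (ℕ.+-suc k k))) ⟩
  Σ< K (λ k → at P (suc n) (k + suc k) * f (suc k)) ∎)
  where
  open ≡-Reasoning
  lem : ∀ a b → 0ℤ * a ⊕ b ≡ b
  lem = solve-∀

*ₛ-dilate⇒refinable : ∀ {f P} → f ≗ P *ₛ dilate f → Refinable P f
*ₛ-dilate⇒refinable {f} {P} eq n K n< =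
  trans (eq n) (trans (*ₛ-comm P (dilate f) n) (dilate-*ₛ-Σ f P n K n<))

-- Residues, valuations and odd parts

module _ {d : ℕ} where

  private
    -- Subtracting the two sides gives ∣q₁ - q₂∣ · d = r₂ - r₁ < d.
    quotient-unique-≤ : ∀ {r₁ r₂ q₁ q₂} → r₁ ≤ r₂ → r₂ < d →
      + r₁ ⊕ q₁ * + d ≡ + r₂ ⊕ q₂ * + d → q₁ ≡ q₂
    quotient-unique-≤ {r₁} {r₂} {q₁} {q₂} r₁≤r₂ r₂<d e =
      ℤ.i-j≡0⇒i≡j q₁ q₂ (ℤ.∣i∣≡0⇒i≡0 (∣∣≡0 ∣ q₁ ⊖ q₂ ∣ (subst (_< d) (sym ∣q∣*d≡) (ℕ.≤-<-trans (ℕ.m∸n≤m r₂ r₁) r₂<d))))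
      where
      lem₂ : ∀ r₁ r₂ a b d → r₁ ⊕ a * d ≡ r₂ ⊕ b * d → (a ⊖ b) * d ≡ r₂ ⊖ r₁
      lem₂ r₁ r₂ a b d e = trans (lem₃ r₁ a b d) (trans (cong (λ x → x ⊖ b * d ⊖ r₁) e) (lem₄ r₁ r₂ b d))
        where
        lem₃ : ∀ r a b d → (a ⊖ b) * d ≡ (r ⊕ a * d) ⊖ b * d ⊖ r
        lem₃ = solve-∀
        lem₄ : ∀ r₁ r₂ b d → (r₂ ⊕ b * d) ⊖ b * d ⊖ r₁ ≡ r₂ ⊖ r₁
        lem₄ = solve-∀
      ∣q∣*d≡ : ∣ q₁ ⊖ q₂ ∣ ℕ.* d ≡ r₂ ∸ r₁
      ∣q∣*d≡ = trans (sym (ℤ.abs-* (q₁ ⊖ q₂) (+ d)))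
        (cong ∣_∣ (trans (lem₂ (+ r₁) (+ r₂) q₁ q₂ (+ d) e) (trans (ℤ.m-n≡m⊖n r₂ r₁) (ℤ.⊖-≥ r₁≤r₂))))
      ∣∣≡0 : ∀ k → k ℕ.* d < d → k ≡ 0
      ∣∣≡0 zero    _ = refl
      ∣∣≡0 (suc k) h = contradiction h (ℕ.≤⇒≯ (ℕ.m≤m+n d (k ℕ.* d)))

  quotient-unique : ∀ {r₁ r₂ q₁ q₂} → r₁ < d → r₂ < d →
    + r₁ ⊕ q₁ * + d ≡ + r₂ ⊕ q₂ * + d → q₁ ≡ q₂
  quotient-unique {r₁} {r₂} r₁<d r₂<d e with ℕ.≤-total r₁ r₂
  ... | inj₁ r₁≤r₂ = quotient-unique-≤ r₁≤r₂ r₂<d e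
  ... | inj₂ r₂≤r₁ = sym (quotient-unique-≤ r₂≤r₁ r₁<d (sym e))

  remainder-unique : ∀ {r₁ r₂ q₁ q₂} → r₁ < d → r₂ < d →
    + r₁ ⊕ q₁ * + d ≡ + r₂ ⊕ q₂ * + d → r₁ ≡ r₂
  remainder-unique {r₁} {r₂} {q₁} {q₂} r₁<d r₂<d e =
    ℤ.+-injective (∙-cancelʳ (q₁ * + d) (+ r₁) (+ r₂)
      (trans e (cong (λ q → + r₂ ⊕ q * + d) (sym (quotient-unique {q₁ = q₁} {q₂} r₁<d r₂<d e)))))

/ℕ-exact : ∀ d .{{_ : ℕ.NonZero d}} a → (+ d * a) /ℕ d ≡ a
/ℕ-exact d a = quotient-unique {d} (ℤ.n%ℕd<d (+ d * a) d) (ℕ.>-nonZero⁻¹ d)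
  (trans (sym (ℤ.a≡a%ℕn+[a/ℕn]*n (+ d * a) d)) (trans (ℤ.*-comm (+ d) a) (sym (ℤ.+-identityˡ (a * + d)))))

mod2^-cong : ∀ s a b → + (2 ^ s) ∣ℤ a ⊖ b → a mod2^ s ≡ b mod2^ s
mod2^-cong s a b (divides z e) = fromℕ<-cong _ _
  (remainder-unique {d = 2 ^ s} {q₁ = a /ℕ d} {q₂ = b /ℕ d ⊕ z} (ℤ.n%ℕd<d a d) (ℤ.n%ℕd<d b d) (begin
    + (a %ℕ d) ⊕ a /ℕ d * + d          ≡⟨ ℤ.a≡a%ℕn+[a/ℕn]*n a d ⟨
    a                                  ≡⟨ lem a b ⟩
    b ⊕ (a ⊖ b)                        ≡⟨ cong₂ _⊕_ (ℤ.a≡a%ℕn+[a/ℕn]*n b d) e ⟩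
    + (b %ℕ d) ⊕ b /ℕ d * + d ⊕ z * + d ≡⟨ lem₂ (+ (b %ℕ d)) (b /ℕ d) z (+ d) ⟩
    + (b %ℕ d) ⊕ (b /ℕ d ⊕ z) * + d    ∎))
  (ℤ.n%ℕd<d a d) (ℤ.n%ℕd<d b d)
  where
  open ≡-Reasoning
  d = 2 ^ s
  instance
    d-nonZero : ℕ.NonZero d
    d-nonZero = ℕ.m^n≢0 2 s
  lem : ∀ a b → a ≡ b ⊕ (a ⊖ b)
  lem = solve-∀
  lem₂ : ∀ r q z d → r ⊕ q * d ⊕ z * d ≡ r ⊕ (q ⊕ z) * d
  lem₂ = solve-∀

toℕ-mod2^ : ∀ s a → + (2 ^ s) ∣ℤ + toℕ (a mod2^ s) ⊖ a
toℕ-mod2^ s a = divides (ℤ.- (a /ℕ d)) (begin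
  + toℕ (a mod2^ s) ⊖ a                     ≡⟨ cong₂ _⊖_ (cong +_ (toℕ-fromℕ< (ℤ.n%ℕd<d a d))) (ℤ.a≡a%ℕn+[a/ℕn]*n a d) ⟩
  + (a %ℕ d) ⊖ (+ (a %ℕ d) ⊕ a /ℕ d * + d)  ≡⟨ lem (+ (a %ℕ d)) (a /ℕ d) (+ d) ⟩
  ℤ.- (a /ℕ d) * + d                        ∎)
  where
  open ≡-Reasoning
  d = 2 ^ s
  instance
    d-nonZero : ℕ.NonZero d
    d-nonZero = ℕ.m^n≢0 2 s
  lem : ∀ r q d → r ⊖ (r ⊕ q * d) ≡ ℤ.- q * d
  lem = solve-∀

mod2^-Σ : ∀ s K (c a : ℕ → ℤ) (v : Fin K → Fin (2 ^ s)) → (∀ i → v i ≡ a (toℕ i) mod2^ s) →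
  sum {K} (λ i → c (toℕ i) * + toℕ (v i)) mod2^ s ≡ Σ< K (λ k → c k * a k) mod2^ s
mod2^-Σ s K c a v v≡ = trans (cong (_mod2^ s) (sum-cong-≗ {K} λ i → cong (λ x → c (toℕ i) * + toℕ x) (v≡ i)))
  (mod2^-cong s (Σ< K (λ k → c k * b k)) (Σ< K (λ k → c k * a k))
    (subst (+ (2 ^ s) ∣ℤ_) diff (Σ-∣ K λ k _ → ℤ∣.∣n⇒∣m*n (c k) (toℕ-mod2^ s (a k)))))
  where
  b : ℕ → ℤ
  b k = + toℕ (a k mod2^ s)
  lem : ∀ c a b → c * b ≡ c * (b ⊖ a) ⊕ c * a
  lem = solve-∀
  lem₂ : ∀ x y → x ≡ (x ⊕ y) ⊖ y
  lem₂ = solve-∀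
  diff : Σ< K (λ k → c k * (b k ⊖ a k)) ≡ Σ< K (λ k → c k * b k) ⊖ Σ< K (λ k → c k * a k)
  diff = trans (lem₂ (Σ< K (λ k → c k * (b k ⊖ a k))) (Σ< K (λ k → c k * a k)))
    (cong (_⊖ Σ< K (λ k → c k * a k))
    (sym (trans (Σ-cong {g = λ k → c k * (b k ⊖ a k) ⊕ c k * a k} K (λ k _ → lem (c k) (a k) (b k)))
                (Σ-distrib-+ {λ k → c k * (b k ⊖ a k)} {λ k → c k * a k} K))))

-- The residue is 2^e (o + 2^(s+d-e) z) for some z, so exact division by 2^e loses e bits of
-- precision. The d ≥ e spare bits cover the loss.
mod2^-/ℕ : ∀ s d e o → e ≤ d →
  _/ℕ_ (+ toℕ ((+ (2 ^ e) * o) mod2^ (s + d))) (2 ^ e) {{ℕ.m^n≢0 2 e}} mod2^ s ≡ o mod2^ s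
mod2^-/ℕ s d e o e≤d with toℕ-mod2^ (s + d) (+ (2 ^ e) * o)
... | divides z eq = trans (cong (_mod2^ s) quotient≡)
  (mod2^-cong s (o ⊕ + (2 ^ s) * + (2 ^ (d ∸ e)) * z) o
    (divides (+ (2 ^ (d ∸ e)) * z) (lem₂ o (+ (2 ^ s)) (+ (2 ^ (d ∸ e))) z)))
  where
  instance
    2^e-nonZero : ℕ.NonZero (2 ^ e)
    2^e-nonZero = ℕ.m^n≢0 2 e
  residue = + toℕ ((+ (2 ^ e) * o) mod2^ (s + d))
  2^≡ : + (2 ^ (s + d)) ≡ + (2 ^ e) * (+ (2 ^ s) * + (2 ^ (d ∸ e)))
  2^≡ = trans (cong (λ x → + (2 ^ x)) (trans (cong (s ℕ.+_) (sym (ℕ.m+[n∸m]≡n e≤d))) (lem s e (d ∸ e))))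
    (trans (cong +_ (trans (ℕ.^-distribˡ-+-* 2 e (s + (d ∸ e))) (cong (2 ^ e ℕ.*_) (ℕ.^-distribˡ-+-* 2 s (d ∸ e)))))
      (trans (ℤ.pos-* (2 ^ e) (2 ^ s ℕ.* 2 ^ (d ∸ e))) (cong (+ (2 ^ e) *_) (ℤ.pos-* (2 ^ s) (2 ^ (d ∸ e))))))
    where
    lem : ∀ s e x → s + (e + x) ≡ e + (s + x)
    lem = ℕ-Solver.solve-∀
  residue≡ : residue ≡ + (2 ^ e) * (o ⊕ + (2 ^ s) * + (2 ^ (d ∸ e)) * z)
  residue≡ = trans (lem residue (+ (2 ^ e) * o)) (trans (cong (+ (2 ^ e) * o ⊕_) (trans eq (cong (z *_) 2^≡)))
    (lem₁ (+ (2 ^ e)) o z (+ (2 ^ s)) (+ (2 ^ (d ∸ e)))))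
    where
    lem : ∀ a b → a ≡ b ⊕ (a ⊖ b)
    lem = solve-∀
    lem₁ : ∀ g o z s x → g * o ⊕ z * (g * (s * x)) ≡ g * (o ⊕ s * x * z)
    lem₁ = solve-∀
  quotient≡ : residue /ℕ (2 ^ e) ≡ o ⊕ + (2 ^ s) * + (2 ^ (d ∸ e)) * z
  quotient≡ = trans (cong (_/ℕ (2 ^ e)) residue≡) (/ℕ-exact (2 ^ e) _)
  lem₂ : ∀ o s x z → o ⊕ s * x * z ⊖ o ≡ x * z * s
  lem₂ = solve-∀

Valued : ℤ → ℕ → Set
Valued a v = ∃ λ o → Odd o × a ≡ + (2 ^ v) * o

module _ {v : ℕ} {o : ℤ} (o-odd : Odd o) where

  private
    a = + (2 ^ v) * o
    instance
      2^v-nonZero : ℕ.NonZero (2 ^ v)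
      2^v-nonZero = ℕ.m^n≢0 2 v

    2^v∣a : 2 ^ v ℕ∣.∣ ∣ a ∣
    2^v∣a = ℤ∣.∣⇒∣ᵤ {+ (2 ^ v)} {a} (ℤ∣.∣m⇒∣m*n {m = + (2 ^ v)} o ℤ∣.∣-refl)

    2^suc-v∤a : ¬ 2 ^ suc v ℕ∣.∣ ∣ a ∣
    2^suc-v∤a d with ℤ∣.∣ᵤ⇒∣ {+ (2 ^ suc v)} {a} d
    ... | divides z e = even∧odd⇒⊥ (divides z (ℤ.*-cancelˡ-≡ (+ (2 ^ v)) _ _ {{2^v-nonZero}}
            (trans e (trans (cong (z *_) (pos-2^suc v)) (lem z (+ (2 ^ v))))))) o-odd
      where
      lem : ∀ z g → z * (+ 2 * g) ≡ g * (z * + 2)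
      lem = solve-∀

    valuation : ∀ n → ¬ 2 ^ suc v ℕ∣.∣ n → 2 ^ v ℕ∣.∣ n → ν₂ℕ n ≡ [ v ]
    valuation zero      ¬d _ = contradiction (ℕ∣.divides 0 refl) ¬d
    valuation n@(suc _) ¬d d = cong [_] (ℕ.≤-antisym
      (ℕ.≮⇒≥ λ v<w → ¬d (ℕ∣.∣-trans (2^-mono-∣ v<w) (ν₂ℕ-divides n refl)))
      (ν₂ℕ-maximal n refl d))
      where
      2^-mono-∣ : ∀ {i j} → i ≤ j → 2 ^ i ℕ∣.∣ 2 ^ j
      2^-mono-∣ {i} {j} i≤j = ℕ∣.divides (2 ^ (j ∸ i))
        (trans (cong (2 ^_) (sym (ℕ.m∸n+n≡m i≤j))) (ℕ.^-distribˡ-+-* 2 (j ∸ i) i))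

  ν₂-2^* : ν₂ a ≡ [ v ]
  ν₂-2^* = valuation ∣ a ∣ 2^suc-v∤a 2^v∣a

  odd-2^* : odd a ≡ o
  odd-2^* = trans (cong (a /2^⁺_) ν₂-2^*) (/ℕ-exact (2 ^ v) o)

Valued⇒ν₂ : ∀ {a v} → Valued a v → ν₂ a ≡ [ v ]
Valued⇒ν₂ {v = v} (o , o-odd , refl) = ν₂-2^* {v} {o} o-odd

Valued⇒odd : ∀ {a v} → Valued a v → Odd (odd a) × a ≡ + (2 ^ v) * odd a
Valued⇒odd {v = v} (o , o-odd , refl) = subst Odd (sym odd≡) o-odd , cong (+ (2 ^ v) *_) (sym odd≡)
  where
  odd≡ = odd-2^* {v} {o} o-odd

Odd⇒Valued : ∀ {a} → Odd a → Valued a 0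
Odd⇒Valued {a} a-odd = a , a-odd , sym (ℤ.*-identityˡ a)

-- Parity of the coefficients, and even q

halve : ∀ n → ∃ λ k → n ≡ k + k ⊎ n ≡ suc (k + k)
halve zero = 0 , inj₁ refl
halve (suc n) with halve n
... | k , inj₁ refl = k , inj₂ refl
... | k , inj₂ refl = suc k , inj₁ (cong suc (sym (ℕ.+-suc k k)))

double≢suc-double : ∀ a b → a + a ≢ suc (b + b)
double≢suc-double (suc a) (suc b) e =
  double≢suc-double a b (ℕ.suc-injective
    (trans (sym (ℕ.+-suc a a)) (trans (ℕ.suc-injective e) (cong suc (ℕ.+-suc b b)))))
double≢suc-double (suc zero) zero ()
double≢suc-double (suc (suc a)) zero ()

double-injective : ∀ a b → a + a ≡ b + b → a ≡ b
double-injective zero    zero    _ = refl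
double-injective (suc a) (suc b) e =
  cong suc (double-injective a b (ℕ.suc-injective
    (trans (sym (ℕ.+-suc a a)) (trans (ℕ.suc-injective e) (ℕ.+-suc b b)))))

-- All that the argument uses of (1 + ε x)^m. Keeping ε out of sight lets T^m and (1 - x)^(-m) share
-- every later lemma. The field `absorb` says x P′ = m Q, and the parity fields say that P is 1 +
-- x^m modulo 2.
record Mask (m : ℕ) : Set where
  field
    P Q    : Series
    absorb : ∀ e → + e * P e ≡ + m * Q e
    P-zero : Odd (P 0)
    P-top  : Odd (P m)
    P-mid  : ∀ {e} → 0 < e → e < m → Even (P e)
    P-high : ∀ e → m < e → P e ≡ 0ℤ
    Q-low  : ∀ {e} → 0 < e → e ≤ m → Odd (Q e)
    Q-high : ∀ e → m < e → Q e ≡ 0ℤ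

  -- This is `absorb` at e = x - y with the subtraction moved to the other side. It stays true for x
  -- < y, where both coefficients vanish.
  at-absorb : ∀ x y → + x * at P x y ≡ + y * at P x y ⊕ + m * at Q x y
  at-absorb x       zero    = trans (absorb x) (lem (P x) (+ m * Q x))
    where
    lem : ∀ a b → b ≡ 0ℤ * a ⊕ b
    lem = solve-∀
  at-absorb zero    (suc y) = lem (+ suc y) (+ m)
    where
    lem : ∀ y m → 0ℤ * 0ℤ ≡ y * 0ℤ ⊕ m * 0ℤ
    lem = solve-∀
  at-absorb (suc x) (suc y) = begin
    (1ℤ ⊕ + x) * p                 ≡⟨ lem₁ (+ x) p ⟩
    p ⊕ + x * p                    ≡⟨ cong (p ⊕_) (at-absorb x y) ⟩
    p ⊕ (+ y * p ⊕ + m * at Q x y) ≡⟨ lem₂ (+ y) p (+ m * at Q x y) ⟩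
    (1ℤ ⊕ + y) * p ⊕ + m * at Q x y ∎
    where
    open ≡-Reasoning
    p = at P x y
    lem₁ : ∀ x p → (1ℤ ⊕ x) * p ≡ p ⊕ x * p
    lem₁ = solve-∀
    lem₂ : ∀ y p b → p ⊕ (y * p ⊕ b) ≡ (1ℤ ⊕ y) * p ⊕ b
    lem₂ = solve-∀

  at-P-even : ∀ x y → x ≢ y → x ≢ y + m → Even (at P x y)
  at-P-even x y x≢y x≢y+m with ℕ.<-cmp x y
  ... | tri< x<y _ _ = subst Even (sym (at-neg P x<y)) (divides 0ℤ refl)
  ... | tri≈ _ x≡y _ = contradiction x≡y x≢y
  ... | tri> _ _ y<x with ℕ.<-cmp x (y + m)
  ...   | tri< x<y+m _ _ = subst Even (sym at≡P) (P-mid (ℕ.m<n⇒0<n∸m y<x)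
            (ℕ.+-cancelˡ-< y _ _ (subst (_< y + m) (sym y+[x∸y]≡x) x<y+m)))
          where
          y+[x∸y]≡x : y + (x ∸ y) ≡ x
          y+[x∸y]≡x = ℕ.m+[n∸m]≡n (ℕ.<⇒≤ y<x)
          at≡P : at P x y ≡ P (x ∸ y)
          at≡P = trans (cong (λ z → at P z y) (sym y+[x∸y]≡x)) (at-nonneg P y (x ∸ y))
  ...   | tri≈ _ x≡y+m _ = contradiction x≡y+m x≢y+m
  ...   | tri> _ _ y+m<x = subst Even (sym (at-large P P-high y+m<x)) (divides 0ℤ refl)

-- For 0 < k < 2^r, exponent = r - ν₂(k) and cofactor is the odd part of k.
record Weight (r k : ℕ) : Set where
  field
    exponent cofactor : ℕ
    balance      : k ℕ.* 2 ^ exponent ≡ 2 ^ r ℕ.* cofactor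
    exponent≤    : exponent ≤ r
    positive     : 0 < k → k < 2 ^ r → 0 < exponent
    cofactor-odd : 0 < k → k < 2 ^ r → Odd (+ cofactor)
    zero-exponent : k ≡ 0 → exponent ≡ 0

odd-suc-double : ∀ l → Odd (+ suc (l + l))
odd-suc-double l =
  odd+even {1ℤ} {+ (l + l)} odd-1 (divides (+ l) (trans (cong +_ (lem l)) (ℤ.pos-* l 2)))
  where
  lem : ∀ l → l + l ≡ l ℕ.* 2
  lem = ℕ-Solver.solve-∀

2^suc≡ : ∀ r → 2 ^ suc r ≡ 2 ^ r + 2 ^ r
2^suc≡ r = cong (2 ^ r ℕ.+_) (ℕ.+-identityʳ (2 ^ r))

double-cancel-< : ∀ {a b} → a + a < b + b → a < b
double-cancel-< {a} {b} a+a<b+b = ℕ.≰⇒> λ b≤a → ℕ.<⇒≱ a+a<b+b (ℕ.+-mono-≤ b≤a b≤a)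

-- `k` is halved at most r times, so a weight exists for every `k`. At k = 0 all r halvings succeed
-- and leave exponent 0, which is the valuation of the coefficients at multiples of m.
weight : ∀ r k → Weight r k
weight zero k = record
  { exponent = 0 ; cofactor = k ; balance = trans (ℕ.*-identityʳ k) (sym (ℕ.+-identityʳ k)) ; exponent≤ = z≤n
  ; positive = λ { (s≤s _) (s≤s ()) } ; cofactor-odd = λ { (s≤s _) (s≤s ()) } ; zero-exponent = λ _ → refl }
weight (suc r) k with halve k
... | l , inj₂ refl = record
  { exponent = suc r ; cofactor = k ; balance = ℕ.*-comm k (2 ^ suc r) ; exponent≤ = ℕ.≤-refl
  ; positive = λ _ _ → s≤s z≤n ; cofactor-odd = λ _ _ → odd-suc-double l ; zero-exponent = λ () }
... | l , inj₁ refl = record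
  { exponent = exponent ; cofactor = cofactor
  ; balance = trans (lem₁ l (2 ^ exponent)) (trans (cong (2 ℕ.*_) balance) (sym (ℕ.*-assoc 2 (2 ^ r) cofactor)))
  ; exponent≤ = ℕ.m≤n⇒m≤1+n exponent≤
  ; positive = λ 0<k k<m → positive (half-positive l 0<k) (double-cancel-< (subst (l + l <_) (2^suc≡ r) k<m))
  ; cofactor-odd = λ 0<k k<m → cofactor-odd (half-positive l 0<k) (double-cancel-< (subst (l + l <_) (2^suc≡ r) k<m))
  ; zero-exponent = λ k≡0 → zero-exponent (ℕ.m+n≡0⇒m≡0 l k≡0) }
  where
  open Weight (weight r l)
  lem₁ : ∀ l a → (l + l) ℕ.* a ≡ 2 ℕ.* (l ℕ.* a)
  lem₁ = ℕ-Solver.solve-∀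
  half-positive : ∀ l → 0 < l + l → 0 < l
  half-positive (suc l) _ = s≤s z≤n

module _ {P : Series} {f : Series} (refinable : Refinable P f) where

  -- With n and k standing for the positions n - D and k - D, the index of P is (n - D) - 2(k - D) =
  -- n + D - 2k. Negative positions carry 0, so a window that starts before position 0 obeys the
  -- same recurrence.
  refinable-at : ∀ D n K → n + D < K + K → at f n D ≡ Σ< K (λ k → at P (n + D) (k + k) * at f k D)
  refinable-at D n K n+D< with ℕ.≤-<-connex D n
  ... | inj₂ n<D = trans (at-neg f n<D) (sym (Σ-zero K λ k _ → vanish k))
    where
    vanish : ∀ k → at P (n + D) (k + k) * at f k D ≡ 0ℤ
    vanish k with ℕ.≤-<-connex D k
    ... | inj₁ D≤k = cong (_* at f k D) (at-neg P (ℕ.<-≤-trans (ℕ.+-monoˡ-< D n<D) (ℕ.+-mono-≤ D≤k D≤k)))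
    ... | inj₂ k<D = trans (cong (at P (n + D) (k + k) *_) (at-neg f k<D)) (ℤ.*-zeroʳ (at P (n + D) (k + k)))
  ... | inj₁ D≤n with ℕ.m≤n⇒∃[o]m+o≡n D≤n
                  | ℕ.m≤n⇒∃[o]m+o≡n {D} {K} (ℕ.<⇒≤ (double-cancel-< (ℕ.≤-<-trans (ℕ.+-monoˡ-≤ D D≤n) n+D<)))
  ... | n₀ , refl | K₀ , refl = begin
    at f (D + n₀) D
      ≡⟨ at-nonneg f D n₀ ⟩
    f n₀
      ≡⟨ refinable n₀ K₀ (ℕ.+-cancelˡ-< (D + D) n₀ (K₀ + K₀) (subst₂ _<_ (lem₁ D n₀) (lem₂ D K₀) n+D<)) ⟩
    Σ< K₀ (λ k → at P n₀ (k + k) * f k)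
      ≡⟨ Σ-cong {λ k → at P n₀ (k + k) * f k}
                {λ k → at P (D + n₀ + D) ((D + k) + (D + k)) * at f (D + k) D} K₀
           (λ k _ → sym (cong₂ _*_ (at-shift P {D + n₀ + D} {(D + k) + (D + k)} {n₀} {k + k} (lem₃ D n₀ k))
                                   (at-nonneg f D k))) ⟩
    Σ< K₀ (λ k → at P (D + n₀ + D) ((D + k) + (D + k)) * at f (D + k) D)
      ≡⟨ Σ-drop D K₀ (λ k k<D → trans (cong (at P (D + n₀ + D) (k + k) *_) (at-neg f k<D))
                                      (ℤ.*-zeroʳ (at P (D + n₀ + D) (k + k)))) ⟨
    Σ< (D + K₀) (λ k → at P (D + n₀ + D) (k + k) * at f k D) ∎
    where
    open ≡-Reasoning
    lem₁ : ∀ D n → D + n + D ≡ D + D + n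
    lem₁ = ℕ-Solver.solve-∀
    lem₂ : ∀ D k → (D + k) + (D + k) ≡ D + D + (k + k)
    lem₂ = ℕ-Solver.solve-∀
    lem₃ : ∀ D n k → D + n + D + (k + k) ≡ n + ((D + k) + (D + k))
    lem₃ = ℕ-Solver.solve-∀

  -- P lives in degrees 0 to m, so `k` contributes only if n + D - m ≤ 2k ≤ n + D. The two
  -- inequalities assumed say that b, ..., b + L - 1 covers this range.
  refinable-window : ∀ {m} → (∀ e → m < e → P e ≡ 0ℤ) → ∀ D n b L →
    n + D < (b + L) + (b + L) → (∀ k → k < b → k + k + m < n + D) →
    at f n D ≡ Σ< L (λ k → at P (n + D) ((b + k) + (b + k)) * at f (b + k) D)
  refinable-window P-high D n b L hi lo =
    trans (refinable-at D n (b + L) hi)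
          (Σ-drop b L λ k k<b → cong (_* at f k D) (at-large P P-high (lo k k<b)))

module PowerOfTwo (r′ : ℕ) where

  H = 2 ^ r′
  m = 2 ^ suc r′

  0<m : 0 < m
  0<m = ℕ.m^n>0 2 (suc r′)

  m≡H+H : m ≡ H + H
  m≡H+H = 2^suc≡ r′

  0<H : 0 < H
  0<H = ℕ.m^n>0 2 r′

  H<m : H < m
  H<m = subst (H <_) (sym m≡H+H) (ℕ.m<m+n H 0<H)

  instance
    m-nonZero : ℤ.NonZero (+ m)
    m-nonZero = ℕ.m^n≢0 2 (suc r′)

    m-nonZeroℕ : ℕ.NonZero m
    m-nonZeroℕ = ℕ.m^n≢0 2 (suc r′)


  γ : ℕ → ℕ
  γ k = Weight.exponent (weight (suc r′) k)

  cofactor : ℕ → ℕ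
  cofactor k = Weight.cofactor (weight (suc r′) k)

  -- The factor 2 taken out of 2^γ(k) is the one by which the valuations grow from block q to block
  -- 2q + 1. At k = 0, where γ is 0, truncated subtraction gives the value 1; it only ever meets a
  -- vanishing coefficient.
  half : ℕ → ℤ
  half k = + (2 ^ (γ k ∸ 1))

  record Solution (M : Mask m) (f : Series) : Set where
    open Mask M
    field
      refinable : Refinable P f
      f0-odd    : Odd (f 0)

  module _ {M : Mask m} {f : Series} (S : Solution M f) where
    open Mask M
    open Solution S

    private
      multiple? : ∀ k → (∃ λ p → k ≡ p ℕ.* m) ⊎ (∀ p → k ≢ p ℕ.* m)
      multiple? k with m ℕ∣.∣? k
      ... | yes (ℕ∣.divides p e) = inj₁ (p , e)
      ... | no ¬d = inj₂ λ p e → ¬d (ℕ∣.divides p e)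

      ParityAt : ℕ → Set
      ParityAt n = ((p : ℕ) → n ≡ p ℕ.* m → Odd (f n)) × ((∀ p → n ≢ p ℕ.* m) → Even (f n))

      expand : ∀ n → 0 < n → f n ≡ Σ< n (λ k → at P n (k + k) * f k)
      expand n 0<n = refinable n n (ℕ.m<m+n n 0<n)

      dbl* : ∀ p → p ℕ.* m + p ℕ.* m ≡ (p + p) ℕ.* m
      dbl* p = sym (ℕ.*-distribʳ-+ m p p)

      dbl*′ : ∀ p → p ℕ.* m + p ℕ.* m + m ≡ suc (p + p) ℕ.* m
      dbl*′ p = trans (ℕ.+-comm _ m) (cong (m ℕ.+_) (dbl* p))

      -- Modulo 2 the equation is f(x) = (1 + x^m) f(x²), whose solution with odd constant term is 1
      -- / (1 - x^m).
      parityAt : ∀ n → ParityAt n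
      parityAt = <-rec ParityAt go
        where
        go : ∀ n → (∀ {k} → k < n → ParityAt k) → ParityAt n
        go zero    _   = (λ _ _ → f0-odd) , λ ¬m → contradiction refl (¬m 0)
        go n@(suc _) rec = odd-case , even-case
          where
          0<n : 0 < n
          0<n = s≤s z≤n

          others : ∀ k → k < n → (∀ p → k ≡ p ℕ.* m → n ≢ k + k × n ≢ k + k + m) → Even (at P n (k + k) * f k)
          others k k<n h with multiple? k
          ... | inj₂ ¬m = even*ʳ (at P n (k + k)) (proj₂ (rec k<n) ¬m)
          ... | inj₁ (p , e) = even*ˡ (f k) (at-P-even n (k + k) (proj₁ (h p e)) (proj₂ (h p e)))

          -- By `others` only multiples k = p′ m with n = 2k or n = 2k + m can matter. The parity of
          -- q decides which of the two equations is solvable, and p′ is then q / 2 rounded down.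
          odd-case : ∀ q → n ≡ q ℕ.* m → Odd (f n)
          odd-case q n≡ with halve q
          ... | p , inj₁ refl = subst Odd (sym (expand n 0<n)) (Σ-odd n k₀ k₀<n
                (odd*odd (subst Odd (sym (trans (cong (λ x → at P x (k₀ + k₀)) (trans n≡2k₀ (sym (ℕ.+-identityʳ _))))
                                                (at-nonneg P (k₀ + k₀) 0))) P-zero)
                         (proj₁ (rec k₀<n) p refl))
                λ k k<n k≢k₀ → others k k<n λ { p′ refl →
                  (λ e → k≢k₀ (double-injective _ _ (trans (sym e) n≡2k₀))) ,
                  (λ e → double≢suc-double p p′ (ℕ.*-cancelʳ-≡ _ _ m (trans (sym n≡) (trans e (dbl*′ p′))))) })
            where
            k₀ = p ℕ.* m
            n≡2k₀ : n ≡ k₀ + k₀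
            n≡2k₀ = trans n≡ (sym (dbl* p))
            k₀<n : k₀ < n
            k₀<n = double-cancel-< (subst (_< n + n) n≡2k₀ (ℕ.m<m+n n 0<n))
          ... | p , inj₂ refl = subst Odd (sym (expand n 0<n)) (Σ-odd n k₀ k₀<n
                (odd*odd (subst Odd (sym (trans (cong (λ x → at P x (k₀ + k₀)) n≡2k₀+m) (at-nonneg P (k₀ + k₀) m))) P-top)
                         (proj₁ (rec k₀<n) p refl))
                λ k k<n k≢k₀ → others k k<n λ { p′ refl →
                  (λ e → double≢suc-double p′ p (ℕ.*-cancelʳ-≡ _ _ m (trans (sym (dbl* p′)) (trans (sym e) n≡)))) ,
                  (λ e → k≢k₀ (double-injective _ _ (ℕ.+-cancelʳ-≡ m _ _ (trans (sym e) n≡2k₀+m)))) })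
            where
            k₀ = p ℕ.* m
            n≡2k₀+m : n ≡ k₀ + k₀ + m
            n≡2k₀+m = trans n≡ (sym (dbl*′ p))
            k₀<n : k₀ < n
            k₀<n = subst (k₀ <_) (sym n≡2k₀+m) (ℕ.<-≤-trans (ℕ.m<m+n k₀ 0<m) (ℕ.+-monoˡ-≤ m (ℕ.m≤m+n k₀ k₀)))

          even-case : (∀ p → n ≢ p ℕ.* m) → Even (f n)
          even-case ¬m = subst Even (sym (expand n 0<n)) (Σ-∣ n λ k k<n → others k k<n λ { p refl →
            (λ e → ¬m (p + p) (trans e (dbl* p))) , (λ e → ¬m (suc (p + p)) (trans e (dbl*′ p))) })

    odd-at-multiple : ∀ p → Odd (f (p ℕ.* m))
    odd-at-multiple p = proj₁ (parityAt (p ℕ.* m)) p refl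

    even-off-multiples : ∀ {n} → (∀ p → n ≢ p ℕ.* m) → Even (f n)
    even-off-multiples {n} = proj₂ (parityAt n)

    private
      n*f-expand : ∀ n → 0 < n →
        + n * f n ≡ Σ< n (λ k → + 2 * at P n (k + k) * (+ k * f k) ⊕ + m * (at Q n (k + k) * f k))
      n*f-expand n 0<n = trans (cong (+ n *_) (expand n 0<n))
        (trans (Σ-*ˡ (λ k → at P n (k + k) * f k) n (+ n)) (Σ-cong n λ k _ → term k))
        where
        open ≡-Reasoning
        lem₁ : ∀ n p a → n * (p * a) ≡ n * p * a
        lem₁ = solve-∀
        lem₂ : ∀ k p m q a → ((k ⊕ k) * p ⊕ m * q) * a ≡ + 2 * p * (k * a) ⊕ m * (q * a)
        lem₂ = solve-∀
        term : ∀ k → + n * (at P n (k + k) * f k) ≡ + 2 * at P n (k + k) * (+ k * f k) ⊕ + m * (at Q n (k + k) * f k)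
        term k = begin
          + n * (at P n (k + k) * f k)  ≡⟨ lem₁ (+ n) (at P n (k + k)) (f k) ⟩
          + n * at P n (k + k) * f k    ≡⟨ cong (_* f k) (at-absorb n (k + k)) ⟩
          (+ (k + k) * at P n (k + k) ⊕ + m * at Q n (k + k)) * f k
            ≡⟨ lem₂ (+ k) (at P n (k + k)) (+ m) (at Q n (k + k)) (f k) ⟩
          _ ∎

    -- In `n*f-expand` the part with Q carries the factor m, and the other part is covered by
    -- induction. This is the lower bound r - ν₂(n) for the valuation of a nonzero `f n`; its
    -- quotients `y` are needed to decide when it is sharp.
    m∣n*f : ∀ n → + m ∣ℤ + n * f n
    m∣n*f = <-rec _ go
      where
      go : ∀ n → (∀ {k} → k < n → + m ∣ℤ + k * f k) → + m ∣ℤ + n * f n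
      go zero _ = divides 0ℤ refl
      go n@(suc _) rec = subst (+ m ∣ℤ_) (sym (n*f-expand n (s≤s z≤n))) (Σ-∣ n λ k k<n →
        ℤ∣.∣m∣n⇒∣m+n (ℤ∣.∣n⇒∣m*n (+ 2 * at P n (k + k)) (rec k<n))
                     (ℤ∣.∣m⇒∣m*n {m = + m} (at Q n (k + k) * f k) ℤ∣.∣-refl))

    private
      y : ℕ → ℤ
      y k = ℤ∣._∣_.quotient (m∣n*f k)

      k*f≡m*y : ∀ k → + k * f k ≡ + m * y k
      k*f≡m*y k = trans (ℤ∣._∣_.equality (m∣n*f k)) (ℤ.*-comm (y k) (+ m))

    n*f-odd-part : ∀ p c → 0 < c → c < m → ∃ λ u → + ((p + p) ℕ.* m + c) * f ((p + p) ℕ.* m + c) ≡ + m * u × Odd u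
    n*f-odd-part p c 0<c c<m = u , eq , Σ-odd n k₀ k₀<n odd-term even-term
      where
      n = (p + p) ℕ.* m + c
      k₀ = p ℕ.* m
      0<n : 0 < n
      0<n = ℕ.<-≤-trans 0<c (ℕ.m≤n+m c _)
      term : ℕ → ℤ
      term k = + 2 * at P n (k + k) * y k ⊕ at Q n (k + k) * f k
      u = Σ< n term
      lem : ∀ m p y b → + 2 * p * (m * y) ⊕ m * b ≡ m * (+ 2 * p * y ⊕ b)
      lem = solve-∀
      eq : + n * f n ≡ + m * u
      eq = trans (n*f-expand n 0<n) (trans (Σ-cong {g = λ k → + m * term k} n λ k _ →
             trans (cong (λ z → + 2 * at P n (k + k) * z ⊕ + m * (at Q n (k + k) * f k)) (k*f≡m*y k))
                   (lem (+ m) (at P n (k + k)) (y k) (at Q n (k + k) * f k)))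
             (sym (Σ-*ˡ term n (+ m))))
      n≡ : n ≡ k₀ + k₀ + c
      n≡ = cong (_+ c) (sym (dbl* p))
      k₀<n : k₀ < n
      k₀<n = subst (k₀ <_) (sym n≡) (ℕ.<-≤-trans (ℕ.m<m+n k₀ 0<c) (ℕ.+-monoˡ-≤ c (ℕ.m≤m+n k₀ k₀)))
      even-first : ∀ k → Even (+ 2 * at P n (k + k) * y k)
      even-first k = even*ˡ (y k) (even*ˡ (at P n (k + k)) (divides 1ℤ refl))
      odd-term : Odd (term k₀)
      odd-term = even+odd (even-first k₀) (odd*odd
        (subst Odd (sym (trans (cong (λ x → at Q x (k₀ + k₀)) n≡) (at-nonneg Q (k₀ + k₀) c))) (Q-low 0<c (ℕ.<⇒≤ c<m)))
        (odd-at-multiple p))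
      even-term : ∀ k → k < n → k ≢ k₀ → Even (term k)
      even-term k _ k≢k₀ with multiple? k
      ... | inj₂ ¬m = even+even (even-first k) (even*ʳ (at Q n (k + k)) (even-off-multiples ¬m))
      ... | inj₁ (p′ , refl) = even+even (even-first k) (even*ˡ (f k) (subst Even (sym vanish) (divides 0ℤ refl)))
        where
        -- Here n - 2k = 2(p - p′)m + c with 0 < c < m, which is negative for p < p′ and exceeds m
        -- for p′ < p.
        vanish : at Q n (k + k) ≡ 0ℤ
        vanish with ℕ.<-cmp p p′
        ... | tri< p<p′ _ _ = at-neg Q (ℕ.<-≤-trans (ℕ.+-monoʳ-< _ (ℕ.<-≤-trans c<m (ℕ.m≤m+n m m)))
              (subst₂ _≤_ (lem₁ p m) refl (ℕ.+-mono-≤ (ℕ.*-monoˡ-≤ m p<p′) (ℕ.*-monoˡ-≤ m p<p′))))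
          where
          lem₁ : ∀ p m → suc p ℕ.* m + suc p ℕ.* m ≡ (p + p) ℕ.* m + (m + m)
          lem₁ = ℕ-Solver.solve-∀
        ... | tri≈ _ refl _ = contradiction refl k≢k₀
        ... | tri> _ _ p′<p = at-large Q Q-high {n} {k + k} (ℕ.≤-<-trans
              (ℕ.≤-trans (ℕ.m≤m+n _ m) (subst₂ _≤_ (lem₁ p′ m) (dbl* p)
                (ℕ.+-mono-≤ (ℕ.*-monoˡ-≤ m p′<p) (ℕ.*-monoˡ-≤ m p′<p))))
              (ℕ.m<m+n _ 0<c))
          where
          lem₁ : ∀ p m → suc p ℕ.* m + suc p ℕ.* m ≡ p ℕ.* m + p ℕ.* m + m + m
          lem₁ = ℕ-Solver.solve-∀

-- From q to 2q + 1

module Step (r′ : ℕ) where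
  open PowerOfTwo r′

  γ-balance : ∀ k → + k * + (2 ^ γ k) ≡ + m * + cofactor k
  γ-balance k = trans (sym (ℤ.pos-* k (2 ^ γ k)))
    (trans (cong +_ (Weight.balance (weight (suc r′) k))) (ℤ.pos-* m (cofactor k)))

  γ-positive : ∀ {k} → 0 < k → k < m → 0 < γ k
  γ-positive {k} = Weight.positive (weight (suc r′) k)

  γ-zero : γ 0 ≡ 0
  γ-zero = Weight.zero-exponent (weight (suc r′) 0) refl

  γ≤ : ∀ k → γ k ≤ suc r′
  γ≤ k = Weight.exponent≤ (weight (suc r′) k)

  cofactor-odd : ∀ {k} → 0 < k → k < m → Odd (+ cofactor k)
  cofactor-odd {k} = Weight.cofactor-odd (weight (suc r′) k)

  2*half : ∀ {k} → 0 < k → k < m → + (2 ^ γ k) ≡ + 2 * half k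
  2*half {k} 0<k k<m = trans (cong (λ e → + (2 ^ e)) (sym (ℕ.m+[n∸m]≡n (γ-positive 0<k k<m)))) (pos-2^suc (γ k ∸ 1))

  module _ {M : Mask m} {f : Series} (S : Solution M f) where

    -- Since n = 2pm + c, passing from n f_n to c f_n changes the quotient by m by an even number,
    -- so it remains odd. Then c · 2^γ(c) = m · `cofactor c` turns c f_n = m u′ into 2^γ(c) u′ =
    -- `cofactor c` · f_n, and the odd cofactor is cancelled.
    even-block : ∀ p c → c < m → Valued (f ((p + p) ℕ.* m + c)) (γ c)
    even-block p zero _ = subst₂ (λ n v → Valued (f n) v) (sym (ℕ.+-identityʳ ((p + p) ℕ.* m))) (sym γ-zero)
      (Odd⇒Valued (odd-at-multiple S (p + p)))
    even-block p c@(suc _) c<m = o , odd-*⁻ʳ {+ cofactor c} (subst Odd u′≡ u′-odd) , f≡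
      where
      open ≡-Reasoning
      odd-part = n*f-odd-part S p c (s≤s z≤n) c<m
      u = proj₁ odd-part
      eq = proj₁ (proj₂ odd-part)
      u-odd = proj₂ (proj₂ odd-part)
      n = (p + p) ℕ.* m + c
      c′-odd : Odd (+ cofactor c)
      c′-odd = cofactor-odd (s≤s z≤n) c<m
      u′ = u ⊕ + 2 * (ℤ.- (+ p * f n))
      u′-odd : Odd u′
      u′-odd = odd+even u-odd (even*ˡ (ℤ.- (+ p * f n)) (divides 1ℤ refl))
      pos-n : + n ≡ (+ p ⊕ + p) * + m ⊕ + c
      pos-n = cong (_⊕ + c) (ℤ.pos-* (p + p) m)
      c*f≡ : + c * f n ≡ + m * u′
      c*f≡ = begin
        + c * f n                                            ≡⟨ lem (+ p) (+ m) (+ c) (f n) ⟩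
        ((+ p ⊕ + p) * + m ⊕ + c) * f n ⊖ + 2 * (+ m * (+ p * f n))
          ≡⟨ cong (λ x → x * f n ⊖ + 2 * (+ m * (+ p * f n))) pos-n ⟨
        + n * f n ⊖ + 2 * (+ m * (+ p * f n))                ≡⟨ cong (_⊖ + 2 * (+ m * (+ p * f n))) eq ⟩
        + m * u ⊖ + 2 * (+ m * (+ p * f n))                  ≡⟨ lem₂ (+ m) u (+ p * f n) ⟩
        + m * u′                                             ∎
        where
        lem : ∀ p m c f → c * f ≡ ((p ⊕ p) * m ⊕ c) * f ⊖ + 2 * (m * (p * f))
        lem = solve-∀
        lem₂ : ∀ m u b → m * u ⊖ + 2 * (m * b) ≡ m * (u ⊕ + 2 * (ℤ.- b))
        lem₂ = solve-∀
      2^γ*u′≡ : + (2 ^ γ c) * u′ ≡ + cofactor c * f n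
      2^γ*u′≡ = ℤ.*-cancelˡ-≡ (+ m) _ _ (begin
        + m * (+ (2 ^ γ c) * u′)     ≡⟨ lem (+ m) (+ (2 ^ γ c)) u′ ⟩
        + (2 ^ γ c) * (+ m * u′)     ≡⟨ cong (+ (2 ^ γ c) *_) c*f≡ ⟨
        + (2 ^ γ c) * (+ c * f n)    ≡⟨ lem₂ (+ (2 ^ γ c)) (+ c) (f n) ⟩
        (+ c * + (2 ^ γ c)) * f n    ≡⟨ cong (_* f n) (γ-balance c) ⟩
        (+ m * + cofactor c) * f n   ≡⟨ ℤ.*-assoc (+ m) (+ cofactor c) (f n) ⟩
        + m * (+ cofactor c * f n)   ∎)
        where
        lem : ∀ m g u → m * (g * u) ≡ g * (m * u)
        lem = solve-∀
        lem₂ : ∀ g c f → g * (c * f) ≡ c * g * f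
        lem₂ = solve-∀
      cancelled = odd-cancel-2^ c′-odd (γ c) u′ (f n) 2^γ*u′≡
      o = proj₁ cancelled
      f≡ = proj₁ (proj₂ cancelled)
      u′≡ = proj₂ (proj₂ cancelled)

  module _ (M : Mask m) where
    open Mask M

    module Coefficient (c : ℕ) (0<c : 0 < c) (c<m : c < m) where

      -- For n = (2q + 1)m + c the index n - 2(qm + k) equals m + c - 2k, independently of the block
      -- number. One matrix thus serves all blocks, as a finite automaton requires.
      p q : ℕ → ℤ
      p k = at P (m + c) (k + k)
      q k = at Q (m + c) (k + k)

      -- This is (half k / m) · c · p k, expanded by absorb at m + c - 2k.  It is an
      -- odd multiple of G k, so the parity of G k can be read off.
      combined : ℕ → ℤ
      combined k = + cofactor k * p k ⊕ half k * (q k ⊖ p k)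

      p-zero : p 0 ≡ 0ℤ
      p-zero = P-high (m + c) (ℕ.m<m+n m 0<c)

      q-zero : q 0 ≡ 0ℤ
      q-zero = Q-high (m + c) (ℕ.m<m+n m 0<c)

      private
        2^γ*combined : ∀ k → + (2 ^ γ c) * combined k ≡ + cofactor c * (half k * p k)
        2^γ*combined k with k ℕ.<? m | 0 ℕ.<? k
        ... | no k≮m | _ = vanish (at-neg P m+c<k+k) (at-neg Q m+c<k+k)
          where
          m+c<k+k = ℕ.+-mono-≤-< (ℕ.≮⇒≥ k≮m) (ℕ.<-≤-trans c<m (ℕ.≮⇒≥ k≮m))
          vanish : p k ≡ 0ℤ → q k ≡ 0ℤ → + (2 ^ γ c) * combined k ≡ + cofactor c * (half k * p k)
          vanish p≡ q≡ rewrite p≡ | q≡ = lem (+ (2 ^ γ c)) (+ cofactor k) (half k) (+ cofactor c)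
            where
            lem : ∀ g k′ h c′ → g * (k′ * 0ℤ ⊕ h * (0ℤ ⊖ 0ℤ)) ≡ c′ * (h * 0ℤ)
            lem = solve-∀
        ... | yes k<m | no 0≮k with ℕ.n≤0⇒n≡0 (ℕ.≮⇒≥ 0≮k)
        ...   | refl rewrite p-zero | q-zero = lem (+ (2 ^ γ c)) (+ cofactor 0) (half 0) (+ cofactor c)
            where
            lem : ∀ g k′ h c′ → g * (k′ * 0ℤ ⊕ h * (0ℤ ⊖ 0ℤ)) ≡ c′ * (h * 0ℤ)
            lem = solve-∀
        2^γ*combined k | yes k<m | yes 0<k = ℤ.*-cancelˡ-≡ (+ m) _ _ (begin
          + m * (g * (k′ * p k ⊕ h * (q k ⊖ p k)))
            ≡⟨ lem₁ (+ m) g k′ h (p k) (q k) ⟩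
          g * ((+ m * k′) * p k ⊕ h * (+ m * q k ⊖ + m * p k))
            ≡⟨ cong (λ x → g * (x * p k ⊕ h * (+ m * q k ⊖ + m * p k)))
                 (trans (sym (γ-balance k)) (cong (+ k *_) (2*half 0<k k<m))) ⟩
          g * (+ k * (+ 2 * h) * p k ⊕ h * (+ m * q k ⊖ + m * p k))
            ≡⟨ lem₂ (+ m) g (+ k) h (p k) (q k) ⟩
          g * h * (((+ k ⊕ + k) * p k ⊕ + m * q k) ⊖ + m * p k)
            ≡⟨ cong (λ x → g * h * (x ⊖ + m * p k)) (at-absorb (m + c) (k + k)) ⟨
          g * h * ((+ m ⊕ + c) * p k ⊖ + m * p k)
            ≡⟨ lem₃ (+ m) g h (+ c) (p k) ⟩
          (+ c * g) * (h * p k)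
            ≡⟨ cong (_* (h * p k)) (γ-balance c) ⟩
          + m * + cofactor c * (h * p k)
            ≡⟨ ℤ.*-assoc (+ m) (+ cofactor c) (h * p k) ⟩
          + m * (+ cofactor c * (h * p k)) ∎)
          where
          open ≡-Reasoning
          g = + (2 ^ γ c)
          k′ = + cofactor k
          h = half k
          lem₁ : ∀ m g k′ h p q → m * (g * (k′ * p ⊕ h * (q ⊖ p))) ≡ g * ((m * k′) * p ⊕ h * (m * q ⊖ m * p))
          lem₁ = solve-∀
          lem₂ : ∀ m g k h p q → g * (k * (+ 2 * h) * p ⊕ h * (m * q ⊖ m * p)) ≡ g * h * (((k ⊕ k) * p ⊕ m * q) ⊖ m * p)
          lem₂ = solve-∀
          lem₃ : ∀ m g h c p → g * h * ((m ⊕ c) * p ⊖ m * p) ≡ (c * g) * (h * p)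
          lem₃ = solve-∀

        -- The integrality of the rescaled map: `cofactor c` is odd, so `2^γ*combined` forces 2^γ(c)
        -- to divide `half k * p k`.
        divided : ∀ k → ∃ λ G → half k * p k ≡ + (2 ^ γ c) * G × combined k ≡ + cofactor c * G
        divided k = odd-cancel-2^ (cofactor-odd 0<c c<m) (γ c) (combined k) (half k * p k) (2^γ*combined k)

      G : ℕ → ℤ
      G k = proj₁ (divided k)

      half*p≡ : ∀ k → half k * p k ≡ + (2 ^ γ c) * G k
      half*p≡ k = proj₁ (proj₂ (divided k))

      combined≡ : ∀ k → combined k ≡ + cofactor c * G k
      combined≡ k = proj₂ (proj₂ (divided k))

      private
        c≤m = ℕ.<⇒≤ c<m

        p-even : ∀ k → m + c ≢ k + k → c ≢ k + k → Even (p k)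
        p-even k m+c≢ c≢ = at-P-even (m + c) (k + k) m+c≢
          (λ e → c≢ (ℕ.+-cancelʳ-≡ m _ _ (trans (ℕ.+-comm c m) e)))

        -- P is odd only in degrees 0 and m, that is, for 2k = m + c and 2k = c. For odd c neither
        -- equation has a solution; for even c both solutions lie strictly between 0 and m, and the
        -- two odd terms add up to an even number.
        cofactor-sum-even : ∀ {O : ℕ → ℤ} → (∀ k → 0 < k → k < m → Odd (O k)) →
          Even (Σ< m (λ k → + cofactor k * p k * O k))
        cofactor-sum-even {O} O-odd with halve c
        ... | l , inj₂ c≡ = Σ-∣ m λ k _ → even*ˡ (O k) (even*ʳ (+ cofactor k) (p-even k
              (λ e → double≢suc-double k (H + l) (trans (sym e) (trans (cong₂ _+_ m≡H+H c≡) (lem H l))))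
              (λ e → double≢suc-double k l (trans (sym e) c≡))))
          where
          lem : ∀ H l → H + H + suc (l + l) ≡ suc (H + l + (H + l))
          lem = ℕ-Solver.solve-∀
        ... | l , inj₁ c≡ = Σ-odd₂ m l (H + l) (ℕ.m<n+m l 0<H) H+l<m
              (odd-term 0<l (ℕ.<-trans l<H H<m) (subst Odd (sym p-l) P-top))
              (odd-term (ℕ.<-≤-trans 0<l (ℕ.m≤n+m l H)) H+l<m (subst Odd (sym p-H+l) P-zero))
              λ k _ k≢l k≢H+l → even*ˡ (O k) (even*ʳ (+ cofactor k) (p-even k
                (λ e → k≢H+l (double-injective k (H + l) (trans (sym e) m+c≡)))
                (λ e → k≢l (double-injective k l (trans (sym e) c≡)))))
          where
          lem : ∀ H l → H + H + (l + l) ≡ H + l + (H + l)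
          lem = ℕ-Solver.solve-∀
          m+c≡ : m + c ≡ (H + l) + (H + l)
          m+c≡ = trans (cong₂ _+_ m≡H+H c≡) (lem H l)
          0<l : 0 < l
          0<l = double-cancel-< (subst (0 <_) c≡ 0<c)
          l<H : l < H
          l<H = double-cancel-< (subst₂ _<_ c≡ m≡H+H c<m)
          H+l<m : H + l < m
          H+l<m = subst (H + l <_) (sym m≡H+H) (ℕ.+-monoʳ-< H l<H)
          p-l : p l ≡ P m
          p-l = trans (cong (λ x → at P x (l + l)) (trans (ℕ.+-comm m c) (cong (_+ m) c≡))) (at-nonneg P (l + l) m)
          p-H+l : p (H + l) ≡ P 0
          p-H+l = trans (cong (λ x → at P x (H + l + (H + l))) (trans m+c≡ (sym (ℕ.+-identityʳ _))))
                        (at-nonneg P (H + l + (H + l)) 0)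
          odd-term : ∀ {k} → 0 < k → k < m → Odd (p k) → Odd (+ cofactor k * p k * O k)
          odd-term 0<k k<m p-odd = odd*odd (odd*odd (cofactor-odd 0<k k<m) p-odd) (O-odd _ 0<k k<m)

        -- Here m · `half H` = H · 2^γ(H) = m · `cofactor H`, so `half H` equals an odd cofactor.
        half-H-odd : Odd (half H)
        half-H-odd = subst Odd (sym half≡) (cofactor-odd 0<H H<m)
          where
          half≡ : half H ≡ + cofactor H
          half≡ = ℤ.*-cancelˡ-≡ (+ m) _ _ (trans (trans (trans (cong (_* half H) (ℤ.pos-* 2 H))
            (lem (+ H) (half H))) (cong (+ H *_) (sym (2*half 0<H H<m)))) (γ-balance H))
            where
            lem : ∀ a b → + 2 * a * b ≡ a * (+ 2 * b)
            lem = solve-∀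

        -- An exponent of 1 means 2k = m · cofactor with 0 < 2k < 2m.
        half-even : ∀ {k} → 0 < k → k < m → k ≢ H → Even (half k)
        half-even {k} 0<k k<m k≢H with γ k in γ≡ | γ-positive 0<k k<m | Weight.balance (weight (suc r′) k)
        ... | suc (suc e) | _ | _ = divides (+ (2 ^ e)) (trans (pos-2^suc e) (ℤ.*-comm (+ 2) (+ (2 ^ e))))
        ... | suc zero | _ | bal = contradiction k≡H k≢H
          where
          k≡ : k ≡ H ℕ.* cofactor k
          k≡ = ℕ.*-cancelʳ-≡ _ _ 2 (trans bal (lem H (cofactor k)))
            where
            lem : ∀ H c → 2 ℕ.* H ℕ.* c ≡ H ℕ.* c ℕ.* 2
            lem = ℕ-Solver.solve-∀
          k≡H : k ≡ H
          k≡H with cofactor k | k≡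
          ... | zero        | e = contradiction (trans e (ℕ.*-zeroʳ H)) (ℕ.>⇒≢ 0<k)
          ... | suc zero    | e = trans e (ℕ.*-identityʳ H)
          ... | suc (suc d) | e = contradiction k<m
              (ℕ.≤⇒≯ (subst₂ _≤_ (lem H) (sym e) (ℕ.*-monoʳ-≤ H (s≤s (s≤s (z≤n {d}))))))
            where
            lem : ∀ H → H ℕ.* 2 ≡ 2 ℕ.* H
            lem = ℕ-Solver.solve-∀

        -- Only k = H = m/2 leaves an odd term: there the index m + c - 2k is c, and Q_c - P_c is
        -- odd minus even.
        half-sum-odd : ∀ {O : ℕ → ℤ} → (∀ k → 0 < k → k < m → Odd (O k)) →
          Odd (Σ< m (λ k → half k * (q k ⊖ p k) * O k))
        half-sum-odd {O} O-odd = Σ-odd m H H<m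
          (odd*odd (odd*odd half-H-odd (odd+even q-H (even-neg p-H))) (O-odd H 0<H H<m)) even-term
          where
          at≡ : ∀ R → at R (m + c) (H + H) ≡ R c
          at≡ R = trans (cong (at R (m + c)) (sym m≡H+H)) (at-nonneg R m c)
          q-H : Odd (q H)
          q-H = subst Odd (sym (at≡ Q)) (Q-low 0<c c≤m)
          p-H : Even (p H)
          p-H = subst Even (sym (at≡ P)) (P-mid 0<c c<m)
          even-term : ∀ k → k < m → k ≢ H → Even (half k * (q k ⊖ p k) * O k)
          even-term zero _ _ rewrite p-zero | q-zero = even*ˡ (O 0) (even*ʳ (half 0) (divides 0ℤ refl))
          even-term k@(suc _) k<m k≢H = even*ˡ (O k) (even*ˡ (q k ⊖ p k) (half-even (s≤s z≤n) k<m k≢H))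

      -- Multiplication by the odd `cofactor c` preserves parity and replaces `G` by `combined`,
      -- whose two summands give an even and an odd sum.
      step-odd : ∀ {O : ℕ → ℤ} → (∀ k → 0 < k → k < m → Odd (O k)) → Odd (Σ< m (λ k → G k * O k))
      step-odd {O} O-odd = odd-*⁻ʳ {+ cofactor c}
        (subst Odd (sym eq) (even+odd (cofactor-sum-even O-odd) (half-sum-odd O-odd)))
        where
        open ≡-Reasoning
        lem : ∀ a b o → (a ⊕ b) * o ≡ a * o ⊕ b * o
        lem = solve-∀
        eq : + cofactor c * Σ< m (λ k → G k * O k) ≡
             Σ< m (λ k → + cofactor k * p k * O k) ⊕ Σ< m (λ k → half k * (q k ⊖ p k) * O k)
        eq = begin
          + cofactor c * Σ< m (λ k → G k * O k)
            ≡⟨ Σ-*ˡ (λ k → G k * O k) m (+ cofactor c) ⟩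
          Σ< m (λ k → + cofactor c * (G k * O k))
            ≡⟨ Σ-cong {g = λ k → + cofactor k * p k * O k ⊕ half k * (q k ⊖ p k) * O k} m
                 (λ k _ → trans (sym (ℤ.*-assoc (+ cofactor c) (G k) (O k)))
                   (trans (cong (_* O k) (sym (combined≡ k))) (lem (+ cofactor k * p k) (half k * (q k ⊖ p k)) (O k)))) ⟩
          Σ< m (λ k → + cofactor k * p k * O k ⊕ half k * (q k ⊖ p k) * O k)
            ≡⟨ Σ-distrib-+ {λ k → + cofactor k * p k * O k} {λ k → half k * (q k ⊖ p k) * O k} m ⟩
          _ ∎

      -- Term by term, P · 2^(γ(k)+j) = 2^(j+1) · `half k` · P = 2^(γ(c)+j+1) · `G k`. The extra
      -- power of 2 is the one split off by `half`. The window consists exactly of the positions in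
      -- block q.
      step-value : ∀ {f} → Refinable P f → ∀ {q j} {O : ℕ → ℤ} →
        (∀ k → 0 < k → k < m → f (q ℕ.* m + k) ≡ + (2 ^ (γ k + j)) * O k) →
        f (suc (q + q) ℕ.* m + c) ≡ + (2 ^ (γ c + suc j)) * Σ< m (λ k → G k * O k)
      step-value {f} refinable {q} {j} {O} f≡ = begin
        f n
          ≡⟨ refinable-window {P} {f} refinable P-high 0 n b m hi lo ⟩
        Σ< m (λ k → at P (n + 0) ((b + k) + (b + k)) * f (b + k))
          ≡⟨ Σ-cong {g = λ k → + (2 ^ (γ c + suc j)) * (G k * O k)} m term ⟩
        Σ< m (λ k → + (2 ^ (γ c + suc j)) * (G k * O k))
          ≡⟨ Σ-*ˡ (λ k → G k * O k) m (+ (2 ^ (γ c + suc j))) ⟨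
        + (2 ^ (γ c + suc j)) * Σ< m (λ k → G k * O k) ∎
        where
        open ≡-Reasoning
        n = suc (q + q) ℕ.* m + c
        b = q ℕ.* m
        lem₀ : ∀ q m c → suc (q + q) ℕ.* m + c + 0 ≡ q ℕ.* m + q ℕ.* m + m + c
        lem₀ = ℕ-Solver.solve-∀
        hi : n + 0 < (b + m) + (b + m)
        hi = subst₂ _<_ (sym (lem₀ q m c)) (lem b m) (ℕ.+-monoʳ-< (b + b + m) c<m)
          where
          lem : ∀ b m → b + b + m + m ≡ (b + m) + (b + m)
          lem = ℕ-Solver.solve-∀
        lo : ∀ k → k < b → k + k + m < n + 0
        lo k k<b = subst (k + k + m <_) (sym (lem₀ q m c))
          (ℕ.<-≤-trans (ℕ.+-monoˡ-< m (ℕ.+-mono-< k<b k<b)) (ℕ.m≤m+n (b + b + m) c))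
        shift : ∀ k → at P (n + 0) ((b + k) + (b + k)) ≡ p k
        shift k = at-shift P {n + 0} {(b + k) + (b + k)} {m + c} {k + k}
          (trans (cong (_+ (k + k)) (lem₀ q m c)) (lem b m c k))
          where
          lem : ∀ b m c k → b + b + m + c + (k + k) ≡ m + c + ((b + k) + (b + k))
          lem = ℕ-Solver.solve-∀
        pos-2^+ : ∀ a b → + (2 ^ (a + b)) ≡ + (2 ^ a) * + (2 ^ b)
        pos-2^+ a b = trans (cong +_ (ℕ.^-distribˡ-+-* 2 a b)) (ℤ.pos-* (2 ^ a) (2 ^ b))
        term : ∀ k → k < m → at P (n + 0) ((b + k) + (b + k)) * f (b + k) ≡ + (2 ^ (γ c + suc j)) * (G k * O k)
        -- The hypothesis says nothing about k = 0, where f is odd and has no factor 2 to give. The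
        -- term drops out because P_{m+c} = 0.
        term zero _ = begin
          at P (n + 0) ((b + 0) + (b + 0)) * f (b + 0)  ≡⟨ cong (_* f (b + 0)) (trans (shift 0) p-zero) ⟩
          0ℤ * f (b + 0)                                ≡⟨ lem₁ (f (b + 0)) (+ (2 ^ (γ c + suc j))) (O 0) ⟩
          + (2 ^ (γ c + suc j)) * (0ℤ * O 0)            ≡⟨ cong (λ x → + (2 ^ (γ c + suc j)) * (x * O 0)) G-zero ⟨
          + (2 ^ (γ c + suc j)) * (G 0 * O 0)           ∎
          where
          lem₁ : ∀ a b c → 0ℤ * a ≡ b * (0ℤ * c)
          lem₁ = solve-∀
          instance
            2^γ-nonZero : ℤ.NonZero (+ (2 ^ γ c))
            2^γ-nonZero = ℕ.m^n≢0 2 (γ c)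
          G-zero : G 0 ≡ 0ℤ
          G-zero = ℤ.*-cancelˡ-≡ (+ (2 ^ γ c)) _ _ (trans (sym (half*p≡ 0)) (trans (cong (half 0 *_) p-zero)
            (trans (ℤ.*-zeroʳ (half 0)) (sym (ℤ.*-zeroʳ (+ (2 ^ γ c)))))))
        term k@(suc _) k<m = begin
          at P (n + 0) ((b + k) + (b + k)) * f (b + k)
            ≡⟨ cong₂ _*_ (shift k) (f≡ k (s≤s z≤n) k<m) ⟩
          p k * (+ (2 ^ (γ k + j)) * O k)
            ≡⟨ cong (λ x → p k * (x * O k))
                 (trans (pos-2^+ (γ k) j) (cong (_* + (2 ^ j)) (2*half (s≤s z≤n) k<m))) ⟩
          p k * (+ 2 * half k * + (2 ^ j) * O k)
            ≡⟨ lem₁ (p k) (half k) (+ (2 ^ j)) (O k) ⟩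
          (half k * p k) * (+ 2 * + (2 ^ j)) * O k
            ≡⟨ cong₂ (λ x y → x * y * O k) (half*p≡ k) (sym (pos-2^suc j)) ⟩
          + (2 ^ γ c) * G k * + (2 ^ suc j) * O k
            ≡⟨ lem₂ (+ (2 ^ γ c)) (G k) (+ (2 ^ suc j)) (O k) ⟩
          + (2 ^ γ c) * + (2 ^ suc j) * (G k * O k)
            ≡⟨ cong (_* (G k * O k)) (pos-2^+ (γ c) (suc j)) ⟨
          + (2 ^ (γ c + suc j)) * (G k * O k) ∎
          where
          lem₁ : ∀ p h j o → p * (+ 2 * h * j * o) ≡ (h * p) * (+ 2 * j) * o
          lem₁ = solve-∀
          lem₂ : ∀ c g j o → c * g * j * o ≡ c * j * (g * o)
          lem₂ = solve-∀

  Scaled : Series → ℕ → ℕ → Set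
  Scaled f q j = ∀ c → 0 < c → c < m → Valued (f (q ℕ.* m + c)) (γ c + j)

  module _ {M : Mask m} {f : Series} (S : Solution M f) where

    -- Used twice: oddness of the sum continues the induction on valuations, and its explicit form
    -- is the transition of the automaton on odd parts.
    odd-block : ∀ q {j} → Scaled f q j → ∀ c (0<c : 0 < c) (c<m : c < m) →
      let o = Σ< m (λ k → Coefficient.G M c 0<c c<m k * odd (f (q ℕ.* m + k))) in
      Odd o × f (suc (q + q) ℕ.* m + c) ≡ + (2 ^ (γ c + suc j)) * o
    odd-block q {j} h c 0<c c<m =
      step-odd (λ k 0<k k<m → proj₁ (Valued⇒odd {v = γ k + j} (h k 0<k k<m))) ,
      step-value (Solution.refinable S) {q} {j} {λ k → odd (f (q ℕ.* m + k))}
        (λ k 0<k k<m → proj₂ (Valued⇒odd {v = γ k + j} (h k 0<k k<m)))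
      where open Coefficient M c 0<c c<m using (step-odd; step-value)

  -- Since j = ν₂(q + 1) is chosen before the solution, any two solutions share it.
  scaled : ∀ q → ∃ λ j → ∀ {M f} → Solution M f → Scaled f q j
  scaled = <-rec _ go
    where
    go : ∀ q → (∀ {p} → p < q → ∃ λ j → ∀ {M f} → Solution M f → Scaled f p j) →
         ∃ λ j → ∀ {M f} → Solution M f → Scaled f q j
    go q rec with halve q
    ... | p , inj₁ refl = 0 , λ {M} {f} S c _ c<m →
          subst (Valued (f ((p + p) ℕ.* m + c))) (sym (ℕ.+-identityʳ (γ c))) (even-block S p c c<m)
    ... | p , inj₂ refl with rec (s≤s (ℕ.m≤m+n p p))
    ...   | j , h = suc j , λ {M} {f} S c 0<c c<m → _ , odd-block S p {j} (h S) c 0<c c<m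

-- The automaton

module _ {S : Set} {K k : ℕ} (encode : S → Fin K) (decode : Fin K → S)
         (Represents : S → ℕ → Set)
         (decode-encode : ∀ {s n} → Represents s n → Represents (decode (encode s)) n)
         (initial : S) (step : S → Bit → S) (output : S → Fin k) {a : ℕ → Fin k}
         (initial-represents : Represents initial 0)
         (step-represents    : ∀ {s n} → Represents s n → ∀ b → Represents (step s b) (toℕ b + n ℕ.* 2))
         (output-represents  : ∀ {s n} → Represents s n → output s ≡ a n)
         where

  -- Reading the most significant digit first is a right fold over the digits listed from the least
  -- significant one, so induction on that list appends one low digit at a time. Correctness is a
  -- relation `Represents`, not an equality of states: decoding an encoded function restores it only
  -- pointwise.
  automatic : 2-Automatic a
  automatic = M , λ n → let ds , ds≡n = toDigits 2 n in
    output-represents (subst (Represents (decode (foldl (DFAO.step M) (DFAO.initial M) (reverse ds)))) ds≡n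
      (subst (λ s → Represents (decode s) (fromDigits ds))
             (sym (reverse-foldl (DFAO.step M) (DFAO.initial M) ds)) (go ds)))
    where
    M : DFAO (Fin k)
    M = record
      { size = K ; initial = encode initial
      ; step = λ s b → encode (step (decode s) b) ; output = output ∘ decode }
    go : ∀ (ds : Expansion 2) → Represents (decode (foldr (flip (DFAO.step M)) (DFAO.initial M) ds)) (fromDigits ds)
    go []       = decode-encode initial-represents
    go (d ∷ ds) = decode-encode (step-represents (go ds) d)

module _ {a b c : ℕ} where

  encode₃ : Fin a × Fin b × Fin c → Fin (a ℕ.* (b ℕ.* c))
  encode₃ (i , j , k) = combine i (combine j k)

  decode₃ : Fin (a ℕ.* (b ℕ.* c)) → Fin a × Fin b × Fin c
  decode₃ x = map₂ (remQuot {b} c) (remQuot {a} (b ℕ.* c) x)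

  decode₃-encode₃ : ∀ x → decode₃ (encode₃ x) ≡ x
  decode₃-encode₃ (i , j , k) =
    trans (cong (map₂ (remQuot {b} c)) (remQuot-combine i (combine j k))) (cong (i ,_) (remQuot-combine j k))

module Automaton (r′ : ℕ) (s : ℕ) {M : Mask (2 ^ suc r′)} {f : Series}
                 (S : PowerOfTwo.Solution r′ M f) where
  open PowerOfTwo r′
  open Step r′
  open Mask M
  open Solution S

  private
    r = suc r′
    L = suc (m + m)

  window : ℕ → ℕ → ℤ
  window q i = at f (q ℕ.* m + i) m

  window-+m : ∀ q c → window q (m + c) ≡ f (q ℕ.* m + c)
  window-+m q c = trans (cong (λ x → at f x m) (lem (q ℕ.* m) m c)) (at-nonneg f m (q ℕ.* m + c))
    where
    lem : ∀ a m c → a + (m + c) ≡ m + (a + c)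
    lem = ℕ-Solver.solve-∀

  windowCoefficient : ℕ → ℕ → ℕ → ℤ
  windowCoefficient b i k = at P (b ℕ.* m + i + m) (k + k)

  -- Why the length is 2m + 1: for a position n - m with n = (2q + b)m + i, b ≤ 1 and i ≤ 2m, the
  -- contributing positions lie between qm - m and qm + m. The window therefore determines its
  -- successor.
  window-step : ∀ q b i → b < 2 → i < L →
    window (b + (q + q)) i ≡ Σ< L (λ k → windowCoefficient b i k * window q k)
  window-step q b i b<2 i<L = trans (refinable-window {P} {f} refinable P-high m n (q ℕ.* m) L hi lo)
    (Σ-cong {g = λ k → windowCoefficient b i k * window q k} L λ k _ → cong (_* window q k)
      (at-shift P {n + m} {(q ℕ.* m + k) + (q ℕ.* m + k)} {b ℕ.* m + i + m} {k + k} (lem q b m i k)))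
    where
    n = (b + (q + q)) ℕ.* m + i
    lem : ∀ q b m i k → (b + (q + q)) ℕ.* m + i + m + (k + k) ≡ b ℕ.* m + i + m + ((q ℕ.* m + k) + (q ℕ.* m + k))
    lem = ℕ-Solver.solve-∀
    n+m≡ : n + m ≡ q ℕ.* m + q ℕ.* m + (b ℕ.* m + i + m)
    n+m≡ = lem₁ q b m i
      where
      lem₁ : ∀ q b m i → (b + (q + q)) ℕ.* m + i + m ≡ q ℕ.* m + q ℕ.* m + (b ℕ.* m + i + m)
      lem₁ = ℕ-Solver.solve-∀
    hi : n + m < (q ℕ.* m + L) + (q ℕ.* m + L)
    hi = subst₂ _<_ (sym n+m≡) (lem₁ (q ℕ.* m) m) (ℕ.+-monoʳ-< (q ℕ.* m + q ℕ.* m)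
      (s≤s (ℕ.≤-trans (ℕ.+-monoˡ-≤ m (ℕ.+-mono-≤ (ℕ.*-monoˡ-≤ m (ℕ.≤-pred b<2)) (ℕ.≤-pred i<L)))
                       (ℕ.n≤1+n (1 ℕ.* m + (m + m) + m)))))
      where
      lem₁ : ∀ a m → a + a + suc (suc (1 ℕ.* m + (m + m) + m)) ≡ (a + suc (m + m)) + (a + suc (m + m))
      lem₁ = ℕ-Solver.solve-∀
    lo : ∀ k → k < q ℕ.* m → k + k + m < n + m
    lo k k< = subst (k + k + m <_) (sym n+m≡) (ℕ.<-≤-trans (ℕ.+-monoˡ-< m (ℕ.+-mono-< k< k<))
      (ℕ.+-monoʳ-≤ (q ℕ.* m + q ℕ.* m) (ℕ.m≤n+m m (b ℕ.* m + i))))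

  -- A state represents n = q m + c through c, the residues of f at
  -- q m - m, …, q m + m, and those of the odd parts of f at q m, …, q m + m - 1.
  Window Odds State : Set
  Window = Fin L → Fin (2 ^ (s + r))
  Odds   = Fin m → Fin (2 ^ s)
  State  = Window × Odds × Fin m

  WindowAt : ℕ → Window → Set
  WindowAt q w = ∀ i → w i ≡ window q (toℕ i) mod2^ (s + r)

  OddsAt : ℕ → Odds → Set
  OddsAt q o = ∀ k → o k ≡ odd (f (q ℕ.* m + toℕ k)) mod2^ s

  Represents : State → ℕ → Set
  Represents (w , o , c) n = ∃ λ q → n ≡ q ℕ.* m + toℕ c × WindowAt q w × OddsAt q o

  nextWindow : ℕ → Window → Window
  nextWindow b w i = sum {L} (λ k → windowCoefficient b (toℕ i) (toℕ k) * + toℕ (w k)) mod2^ (s + r)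

  central : Window → ∀ c → c < m → Fin (2 ^ (s + r))
  central w c c<m = w (fromℕ< (s≤s (ℕ.+-monoʳ-≤ m (ℕ.<⇒≤ c<m))))

  -- The r extra bits in the window are spent here: for even q the valuation is γ(c) ≤ r, so the
  -- quotient is still known modulo 2^s.
  evenOdds : Window → Odds
  evenOdds w c = _/ℕ_ (+ toℕ (central w (toℕ c) (toℕ<n c))) (2 ^ γ (toℕ c)) {{ℕ.m^n≢0 2 (γ (toℕ c))}} mod2^ s

  -- For odd q the valuation is unbounded, so no fixed precision of the window would survive the
  -- division. `G` instead sends the old odd parts to the new ones with no division at run time. For
  -- c = 0 the coefficient is odd and is its own odd part.
  oddOdds′ : Window → Odds → ∀ c → c < m → Dec (0 < c) → Fin (2 ^ s)
  oddOdds′ w o c c<m (yes 0<c) = sum {m} (λ k → Coefficient.G M c 0<c c<m (toℕ k) * + toℕ (o k)) mod2^ s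
  oddOdds′ w o c c<m (no _)    = (+ toℕ (central w c c<m)) mod2^ s

  oddOdds : Window → Odds → Odds
  oddOdds w o c = oddOdds′ w o (toℕ c) (toℕ<n c) (0 ℕ.<? toℕ c)

  nextWindow-correct : ∀ {q w} b → b < 2 → WindowAt q w → WindowAt (b + (q + q)) (nextWindow b w)
  nextWindow-correct {q} {w} b b<2 h i = trans (mod2^-Σ (s + r) L (windowCoefficient b (toℕ i)) (window q) w h)
    (cong (_mod2^ (s + r)) (sym (window-step q b (toℕ i) b<2 (toℕ<n i))))

  central-correct : ∀ {q w} → WindowAt q w → ∀ c c<m → central w c c<m ≡ f (q ℕ.* m + c) mod2^ (s + r)
  central-correct {q} h c c<m = trans (h _) (cong (_mod2^ (s + r))
    (trans (cong (window q) (toℕ-fromℕ< (s≤s (ℕ.+-monoʳ-≤ m (ℕ.<⇒≤ c<m))))) (window-+m q c)))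

  evenOdds-correct : ∀ {p w} → WindowAt (p + p) w → OddsAt (p + p) (evenOdds w)
  evenOdds-correct {p} {w} h i = trans (cong (λ x → _/ℕ_ (+ toℕ x) (2 ^ γ c) {{ℕ.m^n≢0 2 (γ c)}} mod2^ s)
      (trans (central-correct {p + p} {w} h c c<m)
             (cong (_mod2^ (s + r)) (proj₂ (Valued⇒odd {v = γ c} (even-block S p c c<m))))))
    (mod2^-/ℕ s r (γ c) (odd (f ((p + p) ℕ.* m + c))) (γ≤ c))
    where
    c = toℕ i
    c<m = toℕ<n i

  mod2^-toℕ : ∀ a → (+ toℕ (a mod2^ (s + r))) mod2^ s ≡ a mod2^ s
  mod2^-toℕ a = begin
    (+ toℕ (a mod2^ (s + r))) mod2^ s
      ≡⟨ cong (_mod2^ s) (/ℕ-1 (+ toℕ (a mod2^ (s + r)))) ⟨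
    (+ toℕ (a mod2^ (s + r)) /ℕ 1) mod2^ s
      ≡⟨ cong (λ x → (+ toℕ (x mod2^ (s + r)) /ℕ 1) mod2^ s) (ℤ.*-identityˡ a) ⟨
    (+ toℕ ((+ 1 * a) mod2^ (s + r)) /ℕ 1) mod2^ s
      ≡⟨ mod2^-/ℕ s r 0 a z≤n ⟩
    a mod2^ s ∎
    where
    open ≡-Reasoning
    /ℕ-1 : ∀ a → a /ℕ 1 ≡ a
    /ℕ-1 a = trans (cong (_/ℕ 1) (sym (ℤ.*-identityˡ a))) (/ℕ-exact 1 a)

  oddOdds′-correct : ∀ {q w o} → WindowAt (suc (q + q)) w → OddsAt q o → ∀ c c<m d →
    oddOdds′ w o c c<m d ≡ odd (f (suc (q + q) ℕ.* m + c)) mod2^ s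
  oddOdds′-correct {q} {w} {o} hw ho c c<m (yes 0<c) =
    trans (mod2^-Σ s m (Coefficient.G M c 0<c c<m) (λ k → odd (f (q ℕ.* m + k))) o ho)
          (cong (_mod2^ s) (sym odd≡))
    where
    j = proj₁ (scaled q)
    block = odd-block S q {j} (proj₂ (scaled q) S) c 0<c c<m
    odd≡ : odd (f (suc (q + q) ℕ.* m + c)) ≡ Σ< m (λ k → Coefficient.G M c 0<c c<m k * odd (f (q ℕ.* m + k)))
    odd≡ = trans (cong odd (proj₂ block)) (odd-2^* {γ c + suc j} (proj₁ block))
  oddOdds′-correct {q} {w} hw ho c c<m (no 0≮c) =
    trans (cong (λ x → (+ toℕ x) mod2^ s) (central-correct {suc (q + q)} {w} hw c c<m))
      (trans (mod2^-toℕ (f (suc (q + q) ℕ.* m + c))) (cong (_mod2^ s) (sym odd≡)))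
    where
    f-odd : Odd (f (suc (q + q) ℕ.* m + c))
    f-odd = subst (Odd ∘ f)
              (sym (trans (cong (suc (q + q) ℕ.* m ℕ.+_) (ℕ.n≤0⇒n≡0 (ℕ.≮⇒≥ 0≮c))) (ℕ.+-identityʳ _)))
              (odd-at-multiple S (suc (q + q)))
    odd≡ : odd (f (suc (q + q) ℕ.* m + c)) ≡ f (suc (q + q) ℕ.* m + c)
    odd≡ = sym (trans (proj₂ (Valued⇒odd {v = 0} (Odd⇒Valued f-odd))) (ℤ.*-identityˡ _))

  -- Appending the digit b to n = qm + c gives 2qm + x with x = 2c + b < 2m, so the new block is 2q
  -- or 2q + 1 according to whether x < m.
  step′ : State → ∀ x → x < m + m → Dec (x < m) → State
  step′ (w , o , _) x _   (yes x<m) = let w′ = nextWindow 0 w in w′ , evenOdds w′ , fromℕ< x<m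
  step′ (w , o , _) x x<2m (no x≮m) = let w′ = nextWindow 1 w in w′ , oddOdds w′ o ,
    fromℕ< (ℕ.+-cancelˡ-< m (x ∸ m) m (subst (_< m + m) (sym (ℕ.m+[n∸m]≡n (ℕ.≮⇒≥ x≮m))) x<2m))

  shifted : Fin m → Bit → ℕ
  shifted c b = toℕ b + toℕ c ℕ.* 2

  shifted< : ∀ c b → shifted c b < m + m
  shifted< c b = subst (shifted c b <_) (lem m)
    (ℕ.<-≤-trans (ℕ.+-monoˡ-< (toℕ c ℕ.* 2) (toℕ<n b)) (ℕ.*-monoˡ-≤ 2 (toℕ<n c)))
    where
    lem : ∀ m → m ℕ.* 2 ≡ m + m
    lem = ℕ-Solver.solve-∀

  step : State → Bit → State
  step st@(_ , _ , c) b = step′ st (shifted c b) (shifted< c b) (shifted c b ℕ.<? m)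

  step′-correct : ∀ {w o c q} → WindowAt q w → OddsAt q o → ∀ x x<2m d →
    Represents (step′ (w , o , c) x x<2m d) ((q + q) ℕ.* m + x)
  step′-correct {w} {o} {c} {q} hw ho x _ (yes x<m) =
    q + q , cong ((q + q) ℕ.* m ℕ.+_) (sym (toℕ-fromℕ< x<m)) , hw′ , evenOdds-correct {q} hw′
    where
    hw′ : WindowAt (q + q) (nextWindow 0 w)
    hw′ = nextWindow-correct {q} 0 (s≤s z≤n) hw
  step′-correct {w} {o} {c} {q} hw ho x x<2m (no x≮m) =
    suc (q + q) , n≡ , hw′ , λ k → oddOdds′-correct {q} {nextWindow 1 w} {o} hw′ ho (toℕ k) (toℕ<n k) (0 ℕ.<? toℕ k)
    where
    hw′ : WindowAt (suc (q + q)) (nextWindow 1 w)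
    hw′ = nextWindow-correct {q} 1 (s≤s (s≤s z≤n)) hw
    lem : ∀ q m y → (q + q) ℕ.* m + (m + y) ≡ suc (q + q) ℕ.* m + y
    lem = ℕ-Solver.solve-∀
    n≡ : (q + q) ℕ.* m + x ≡ suc (q + q) ℕ.* m + toℕ (proj₂ (proj₂ (step′ (w , o , c) x x<2m (no x≮m))))
    n≡ = trans (cong ((q + q) ℕ.* m ℕ.+_) (sym (ℕ.m+[n∸m]≡n (ℕ.≮⇒≥ x≮m))))
      (trans (lem q m (x ∸ m)) (cong (suc (q + q) ℕ.* m ℕ.+_) (sym (toℕ-fromℕ< _))))

  step-correct : ∀ {st n} → Represents st n → ∀ b → Represents (step st b) (toℕ b + n ℕ.* 2)
  step-correct {st@(w , o , c)} {n} (q , n≡ , hw , ho) b =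
    subst (Represents (step st b)) (sym n≡′)
      (step′-correct {w} {o} {c} {q} hw ho (shifted c b) (shifted< c b) (shifted c b ℕ.<? m))
    where
    lem : ∀ q m c b → b + (q ℕ.* m + c) ℕ.* 2 ≡ (q + q) ℕ.* m + (b + c ℕ.* 2)
    lem = ℕ-Solver.solve-∀
    n≡′ : toℕ b + n ℕ.* 2 ≡ (q + q) ℕ.* m + shifted c b
    n≡′ = trans (cong (λ x → toℕ b + x ℕ.* 2) n≡) (lem q m (toℕ c) (toℕ b))

  initial : State
  initial = (λ i → window 0 (toℕ i) mod2^ (s + r)) , (λ k → odd (f (toℕ k)) mod2^ s) , fromℕ< 0<m

  Code : Set
  Code = Fin ((2 ^ (s + r)) ^ L) × Fin ((2 ^ s) ^ m) × Fin m

  pack : State → Code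
  pack (w , o , c) = funToFin w , funToFin o , c

  unpack : Code → State
  unpack (w , o , c) = finToFun w , finToFun o , c

  decode-encode : ∀ {st n} → Represents st n → Represents (unpack (decode₃ (encode₃ (pack st)))) n
  decode-encode {st@(w , o , c)} {n} (q , n≡ , hw , ho) =
    subst (λ x → Represents (unpack x) n) (sym (decode₃-encode₃ (pack st)))
      (q , n≡ , (λ i → trans (finToFun-funToFin w i) (hw i)) , (λ k → trans (finToFun-funToFin o k) (ho k)))

  odd-automatic : 2-Automatic (λ n → odd (f n) mod2^ s)
  odd-automatic = automatic (encode₃ ∘ pack) (unpack ∘ decode₃) Represents
    (λ {st} → decode-encode {st}) initial step (λ (_ , o , c) → o c)
    (0 , sym (toℕ-fromℕ< 0<m) , (λ _ → refl) , (λ _ → refl))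
    (λ {st} → step-correct {st})
    (λ { {_ , o , c} (q , refl , _ , ho) → ho c })

-- Binomial masks

C-absorb : ∀ n k → suc k ℕ.* (suc n C suc k) ≡ suc n ℕ.* (n C k)
C-absorb n       zero    = trans (ℕ.*-identityˡ _) (trans (nC1≡n (suc n)) (sym (ℕ.*-identityʳ (suc n))))
C-absorb zero    (suc k) = trans (cong (suc (suc k) ℕ.*_) (k>n⇒nCk≡0 {1} {suc (suc k)} (s≤s (s≤s z≤n))))
  (trans (ℕ.*-zeroʳ (suc (suc k))) (sym (trans (ℕ.*-identityˡ (0 C suc k)) (k>n⇒nCk≡0 {0} {suc k} (s≤s z≤n)))))
C-absorb (suc n) (suc k) = begin
  suc (suc k) ℕ.* (suc (suc n) C suc (suc k))
    ≡⟨ cong (suc (suc k) ℕ.*_) (nCk+nC[k+1]≡[n+1]C[k+1] (suc n) (suc k)) ⟨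
  suc (suc k) ℕ.* (a + (suc n C suc (suc k)))
    ≡⟨ lem₁ k a (suc n C suc (suc k)) ⟩
  a + suc k ℕ.* a + suc (suc k) ℕ.* (suc n C suc (suc k))
    ≡⟨ cong₂ (λ x y → a + x + y) (C-absorb n k) (C-absorb n (suc k)) ⟩
  a + suc n ℕ.* (n C k) + suc n ℕ.* (n C suc k)
    ≡⟨ lem₂ n a (n C k) (n C suc k) ⟩
  a + suc n ℕ.* ((n C k) + (n C suc k))
    ≡⟨ cong (λ x → a + suc n ℕ.* x) (nCk+nC[k+1]≡[n+1]C[k+1] n k) ⟩
  suc (suc n) ℕ.* a ∎
  where
  open ≡-Reasoning
  a = suc n C suc k
  lem₁ : ∀ k a b → suc (suc k) ℕ.* (a + b) ≡ a + suc k ℕ.* a + suc (suc k) ℕ.* b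
  lem₁ = ℕ-Solver.solve-∀
  lem₂ : ∀ n a b c → a + suc n ℕ.* b + suc n ℕ.* c ≡ a + suc n ℕ.* (b + c)
  lem₂ = ℕ-Solver.solve-∀

nC0≡1 : ∀ n → n C 0 ≡ 1
nC0≡1 zero    = refl
nC0≡1 (suc n) = refl

odd-^ : ∀ {a} → Odd a → ∀ e → Odd (a ℤ.^ e)
odd-^ a-odd zero    = odd-1
odd-^ a-odd (suc e) = odd*odd a-odd (odd-^ a-odd e)

module _ (r′ : ℕ) {ε : ℤ} (ε-odd : Odd ε) where
  open PowerOfTwo r′
  open Step r′

  private
    m-1 = ℕ.pred m

    suc[m-1] : suc m-1 ≡ m
    suc[m-1] = ℕ.suc-pred m

    C-absorb-m : ∀ e → suc e ℕ.* (m C suc e) ≡ m ℕ.* (m-1 C e)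
    C-absorb-m e = subst (λ x → suc e ℕ.* (x C suc e) ≡ x ℕ.* (m-1 C e)) suc[m-1] (C-absorb m-1 e)

    -- Absorption, multiplied by 2^γ and divided by m, says that an odd cofactor times the binomial
    -- equals 2^γ times an integer, and γ > 0 in this range.
    mC-even : ∀ {e} → 0 < e → e < m → Even (+ (m C e))
    mC-even {suc e} 0<e e<m = even-*⁻ʳ {+ cofactor (suc e)} (cofactor-odd 0<e e<m)
      (subst Even (ℤ.*-cancelˡ-≡ (+ m) _ _ eq) (even*ˡ (half (suc e) * b) (divides 1ℤ refl)))
      where
      open ≡-Reasoning
      b = + (m-1 C e)
      lem₁ : ∀ m h b → m * (+ 2 * (h * b)) ≡ + 2 * h * (m * b)
      lem₁ = solve-∀
      lem₂ : ∀ g c x → g * (c * x) ≡ c * g * x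
      lem₂ = solve-∀
      eq : + m * (+ 2 * (half (suc e) * b)) ≡ + m * (+ cofactor (suc e) * + (m C suc e))
      eq = begin
        + m * (+ 2 * (half (suc e) * b))
          ≡⟨ lem₁ (+ m) (half (suc e)) b ⟩
        + 2 * half (suc e) * (+ m * b)
          ≡⟨ cong₂ _*_ (sym (2*half 0<e e<m)) (trans (sym (ℤ.pos-* m (m-1 C e)))
               (trans (cong +_ (sym (C-absorb-m e))) (ℤ.pos-* (suc e) (m C suc e)))) ⟩
        + (2 ^ γ (suc e)) * (+ suc e * + (m C suc e))
          ≡⟨ lem₂ (+ (2 ^ γ (suc e))) (+ suc e) (+ (m C suc e)) ⟩
        + suc e * + (2 ^ γ (suc e)) * + (m C suc e)
          ≡⟨ cong (_* + (m C suc e)) (γ-balance (suc e)) ⟩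
        + m * + cofactor (suc e) * + (m C suc e)
          ≡⟨ ℤ.*-assoc (+ m) (+ cofactor (suc e)) (+ (m C suc e)) ⟩
        + m * (+ cofactor (suc e) * + (m C suc e)) ∎

    -- By Pascal's rule two neighbours in row m - 1 add up to an inner entry of row m, which is
    -- even. So parity is constant along the row, which starts with 1.
    [m-1]C-odd : ∀ e → e < m → Odd (+ (m-1 C e))
    [m-1]C-odd zero    _     = subst (Odd ∘ +_) (sym (nC0≡1 m-1)) odd-1
    [m-1]C-odd (suc e) 1+e<m = subst Odd lem
      (even+odd (mC-even (s≤s z≤n) 1+e<m) (odd-neg ([m-1]C-odd e (ℕ.<-trans (ℕ.n<1+n e) 1+e<m))))
      where
      odd-neg : ∀ {a} → Odd a → Odd (ℤ.- a)
      odd-neg {a} o = subst Odd (lem′ a) (even+odd (even*ˡ (ℤ.- a) (divides 1ℤ refl)) o)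
        where
        lem′ : ∀ a → + 2 * (ℤ.- a) ⊕ a ≡ ℤ.- a
        lem′ = solve-∀
      lem : + (m C suc e) ⊖ + (m-1 C e) ≡ + (m-1 C suc e)
      lem = trans (cong (λ x → + x ⊖ + (m-1 C e))
                    (trans (cong (_C suc e) (sym suc[m-1])) (sym (nCk+nC[k+1]≡[n+1]C[k+1] m-1 e))))
        (lem′ (+ (m-1 C e)) (+ (m-1 C suc e)))
        where
        lem′ : ∀ a b → (a ⊕ b) ⊖ a ≡ b
        lem′ = solve-∀

    Q : Series
    Q zero    = 0ℤ
    Q (suc e) = ε ℤ.^ suc e * + (m-1 C e)

  binomialMask : Mask m
  binomialMask = record
    { P = λ e → ε ℤ.^ e * + (m C e)
    ; Q = Q
    ; absorb = absorb
    ; P-zero = odd*odd (odd-^ ε-odd 0) (subst (Odd ∘ +_) (sym (nC0≡1 m)) odd-1)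
    ; P-top = odd*odd (odd-^ ε-odd m) (subst (Odd ∘ +_) (sym (nCn≡1 m)) odd-1)
    ; P-mid = λ {e} 0<e e<m → even*ʳ (ε ℤ.^ e) (mC-even 0<e e<m)
    ; P-high = λ e m<e → trans (cong (λ x → ε ℤ.^ e * + x) (k>n⇒nCk≡0 m<e)) (ℤ.*-zeroʳ (ε ℤ.^ e))
    ; Q-low = λ { {suc e} _ e<m → odd*odd (odd-^ ε-odd (suc e)) ([m-1]C-odd e e<m) }
    ; Q-high = λ { (suc e) m<1+e → trans (cong (λ x → ε ℤ.^ suc e * + x)
                     (k>n⇒nCk≡0 (ℕ.≤-pred (subst (_< suc e) (sym suc[m-1]) m<1+e)))) (ℤ.*-zeroʳ (ε ℤ.^ suc e)) }
    }
    where
    absorb : ∀ e → + e * (ε ℤ.^ e * + (m C e)) ≡ + m * Q e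
    absorb zero    = sym (ℤ.*-zeroʳ (+ m))
    absorb (suc e) = begin
      + suc e * (p * + (m C suc e))   ≡⟨ lem (+ suc e) p (+ (m C suc e)) ⟩
      p * (+ suc e * + (m C suc e))   ≡⟨ cong (p *_) (trans (sym (ℤ.pos-* (suc e) (m C suc e)))
                                            (trans (cong +_ (C-absorb-m e)) (ℤ.pos-* m (m-1 C e)))) ⟩
      p * (+ m * + (m-1 C e))         ≡⟨ lem p (+ m) (+ (m-1 C e)) ⟩
      + m * (p * + (m-1 C e))         ∎
      where
      open ≡-Reasoning
      p = ε ℤ.^ suc e
      lem : ∀ a b c → a * (b * c) ≡ b * (a * c)
      lem = solve-∀

  ^ₛ-solution : ∀ {f} → f ≗ linear ε *ₛ dilate f → Odd (f 0) → Solution binomialMask (f ^ₛ m)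
  ^ₛ-solution {f} eq f0-odd = record
    { refinable = *ₛ-dilate⇒refinable {f ^ₛ m} λ n → trans (^ₛ-equation {f} {linear ε} eq m n)
        (*ₛ-cong {g = dilate (f ^ₛ m)} (linear-^ₛ ε m) (λ _ → refl) n)
    ; f0-odd = power-odd m }
    where
    power-odd : ∀ k → Odd ((f ^ₛ k) 0)
    power-odd zero    = odd-1
    power-odd (suc k) = subst Odd (sym (ℤ.+-identityʳ (f 0 * (f ^ₛ k) 0))) (odd*odd f0-odd (power-odd k))

-- Comparison of T^m with (1 - x)^(-m), and the theorem

module _ (r′ : ℕ) where
  open PowerOfTwo r′
  open Step r′

  ν₂-agree : ∀ {M M′ f g} → Solution M f → Solution M′ g → ∀ n → ν₂ (f n) ≡ ν₂ (g n)
  ν₂-agree {M} {M′} {f} {g} S S′ n =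
    subst (λ n → ν₂ (f n) ≡ ν₂ (g n)) (sym n≡) (agree (n % m) (m%n<n n m))
    where
    q = n / m
    n≡ : n ≡ q ℕ.* m + n % m
    n≡ = trans (m≡m%n+[m/n]*n n m) (ℕ.+-comm (n % m) (q ℕ.* m))
    odd-at : ∀ {M f} → Solution M f → Odd (f (q ℕ.* m + 0))
    odd-at {f = f} S = subst (Odd ∘ f) (sym (ℕ.+-identityʳ (q ℕ.* m))) (odd-at-multiple S q)
    agree : ∀ c → c < m → ν₂ (f (q ℕ.* m + c)) ≡ ν₂ (g (q ℕ.* m + c))
    agree zero _ = trans (Valued⇒ν₂ {v = 0} (Odd⇒Valued (odd-at S)))
                         (sym (Valued⇒ν₂ {v = 0} (Odd⇒Valued (odd-at S′))))
    agree c@(suc _) c<m = trans (Valued⇒ν₂ {v = v} (proj₂ (scaled q) S c (s≤s z≤n) c<m))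
                           (sym (Valued⇒ν₂ {v = v} (proj₂ (scaled q) S′ c (s≤s z≤n) c<m)))
      where
      v = γ c + proj₁ (scaled q)

  T^m-solution : Solution (binomialMask r′ {ε = -1ℤ} (odd⁺ (divides 0ℤ refl))) (T ^ₛ m)
  T^m-solution = ^ₛ-solution r′ (odd⁺ (divides 0ℤ refl)) T-equation odd-1

  geometric^m-solution : Solution (binomialMask r′ odd-1) (geometric ^ₛ m)
  geometric^m-solution = ^ₛ-solution r′ odd-1 geometric-equation odd-1

  geometric^m : ∀ n → (geometric ^ₛ m) n ≡ + ((n + m ∸ 1) C (m ∸ 1))
  geometric^m n = begin
    (geometric ^ₛ m) n                 ≡⟨ cong (λ k → (geometric ^ₛ k) n) (ℕ.suc-pred m) ⟨
    (geometric ^ₛ suc (ℕ.pred m)) n    ≡⟨ geometric-^ₛ (ℕ.pred m) n ⟩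
    + ((n + ℕ.pred m) C ℕ.pred m)      ≡⟨ cong₂ (λ a b → + (a C b)) n+pred (ℕ.pred[m∸n]≡m∸[1+n] m 0) ⟩
    + ((n + m ∸ 1) C (m ∸ 1))          ∎
    where
    open ≡-Reasoning
    n+pred : n + ℕ.pred m ≡ n + m ∸ 1
    n+pred = trans (cong (n ℕ.+_) (ℕ.pred[m∸n]≡m∸[1+n] m 0)) (sym (ℕ.+-∸-assoc n 0<m))

theorem1p1 : (r : ℕ) → 1 ≤ r → let m = 2 ^ r in
    ((n : ℕ) → ν₂ (t m n) ≡ ν₂ (+ ((n + m ∸ 1) C (m ∸ 1))))
    × ((s : ℕ) → 1 ≤ s → 2-Automatic (λ n → odd (t m n) mod2^ s))
theorem1p1 (suc r′) _ =
  (λ n → trans (ν₂-agree r′ (T^m-solution r′) (geometric^m-solution r′) n) (cong ν₂ (geometric^m r′ n))) ,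
  λ s _ → Automaton.odd-automatic r′ s (T^m-solution r′)
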